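{- Let $d\ge2$ and $n\ge2$ be integers and let $W=W(D_{n,d};q)$. Then the coefficient sequence $([q^i]W)_{i\ge0}$ is unimodal. Moreover, if $k\ge0$ and $n_k\le n<p_k$, then $[q^{2k}]W$ or $[q^{2k+1}]W$ is a maximum coefficient; if $p_k\le n<n_{k+1}$, then $[q^{2k+2}]W$ is a maximum coefficient and the coefficient sequence is weakly increasing (up to degree $2k+2$).
   Context: For a connected graph $G$, $W(G;q)=\sum_{\{u,v\}}q^{d(u,v)}$ over unordered pairs of distinct vertices, $d$ the graph distance; $[q^i]f$ is the coefficient of $q^i$ in $f$. A sequence $(a_m)_{m\ge0}$ is unimodal if for some index $j$, $a_0\le a_1\le\cdots\le a_j\ge a_{j+1}\ge a_{j+2}\ge\cdots$. The $d$-ary dendrimer $D_{n,d}$ is the tree on vertex set $\{1,\ldots,n\}$ defined inductively: $D_{1,d}$ is the single vertex $1$, and $D_{n,d}$ is obtained from $D_{n-1,d}$ by attaching a new leaf $n$ to the smallest-numbered vertex of $D_{n-1,d}$ having degree $\le d$. Define $n_k=2+(d+1)\frac{d^k-1}{d-1}$, $m_k=3+2d\frac{d^k-1}{d-1}$ and $p_k=m_k+2d^k-1$ for $k\ge0$. -}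

module Defs where

open import Data.Empty using (⊥)
open import Data.Fin using (Fin; zero; suc; fromℕ; inject₁)
import Data.Fin as Fin
import Data.Fin.Properties as Fin
open import Data.Fin.Relation.Unary.Top using (View; view; ‵fromℕ; ‵inj₁; view-fromℕ; view-inject₁)
open import Data.List using (List; []; _∷_; [_]; _++_; length; filter; map; foldr; replicate; allFin; cartesianProduct)
open import Data.List.Relation.Unary.All using (All; []; _∷_)
import Data.List.Relation.Unary.All as All
open import Data.List.Relation.Unary.All.Properties using (all-filter)
open import Data.List.Relation.Unary.AllPairs using ([]; _∷_)
open import Data.List.Relation.Unary.Unique.Propositional using (Unique)
import Data.List.Relation.Unary.Unique.Propositional.Properties as Unique
open import Data.Nat using (ℕ; zero; suc; _+_; _*_; _∸_; _^_; _/_; _≤_; _<_; z≤n; s≤s; _≤?_; NonZero; NonTrivial; >-nonZero; nonTrivial⇒n>1)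
open import Data.Nat.Properties using (≤-trans; n≤1+n; m<n⇒0<n∸m)
open import Data.Product using (∃; _×_; _,_; proj₁; proj₂; uncurry)
open import Level using (0ℓ)
open import Relation.Binary using (Rel; Symmetric; Irreflexive; Decidable)
open import Relation.Binary.PropositionalEquality using (_≡_; refl; sym; trans; subst)
open import Relation.Nullary using (¬_; Dec; yes; no)
open import Relation.Nullary.Decidable using (map′; _×-dec_)
import Relation.Unary as U

least-ℕ : {P : U.Pred ℕ 0ℓ} → U.Decidable P → ∀ w → P w →
          ∃ λ m → P m × (∀ j → j < m → ¬ P j)
least-ℕ P? zero    p = zero , p , λ _ ()
least-ℕ P? (suc w) p with P? zero
... | yes p₀ = zero , p₀ , λ _ ()
... | no ¬p₀ with least-ℕ (λ m → P? (suc m)) w p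
...   | m , pm , min = suc m , pm , λ where
        zero    _         → ¬p₀
        (suc j) (s≤s j<m) → min j j<m

least-Fin : ∀ {n} {P : U.Pred (Fin n) 0ℓ} → U.Decidable P → ∀ w → P w →
            ∃ λ v → P v × (∀ u → u Fin.< v → ¬ P u)
least-Fin P? zero    p = zero , p , λ _ ()
least-Fin P? (suc w) p with P? zero
... | yes p₀ = zero , p₀ , λ _ ()
... | no ¬p₀ with least-Fin (λ v → P? (suc v)) w p
...   | v , pv , min = suc v , pv , λ where
        zero    _         → ¬p₀
        (suc u) (s≤s u<v) → min u u<v

record Graph (n : ℕ) : Set₁ where
  field
    Adj    : Rel (Fin n) 0ℓ
    adj?   : Decidable Adj
    symm   : Symmetric Adj
    irrefl : Irreflexive _≡_ Adj

open Graph public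

degree : ∀ {n} → Graph n → Fin n → ℕ
degree {n} G v = length (filter (adj? G v) (allFin n))

data Walk {n} (G : Graph n) : Fin n → Fin n → ℕ → Set where
  nil  : ∀ {u} → Walk G u u 0
  cons : ∀ {u w v k} → Adj G u w → Walk G w v k → Walk G u v (suc k)

walk? : ∀ {n} (G : Graph n) u v → U.Decidable (Walk G u v)
walk? G u v zero    = map′ (λ { refl → nil }) (λ { nil → refl }) (u Fin.≟ v)
walk? G u v (suc k) =
  map′ (λ { (w , a , p) → cons a p }) (λ { (cons a p) → _ , a , p })
       (Fin.any? (λ w → adj? G u w ×-dec walk? G w v k))

Connected : ∀ {n} → Graph n → Set
Connected G = ∀ u v → ∃ (Walk G u v)

dist : ∀ {n} (G : Graph n) → Connected G → Fin n → Fin n → ℕ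
dist G c u v = proj₁ (least-ℕ (walk? G u v) (proj₁ (c u v)) (proj₂ (c u v)))

-- Polynomials in q over ℕ, as lists of coefficients in ascending degree
-- (trailing zeros allowed).
Poly : Set
Poly = List ℕ

infixl 6 _⊕_

_⊕_ : Poly → Poly → Poly
[]      ⊕ g       = g
(a ∷ f) ⊕ []      = a ∷ f
(a ∷ f) ⊕ (b ∷ g) = (a + b) ∷ (f ⊕ g)

q^_ : ℕ → Poly
q^ k = replicate k 0 ++ [ 1 ]

[q^_]_ : ℕ → Poly → ℕ
[q^ _     ] []      = 0
[q^ zero  ] (a ∷ f) = a
[q^ suc i ] (a ∷ f) = [q^ i ] f

-- Each unordered pair of distinct vertices is listed once, smaller vertex first.
pairs : ∀ n → List (Fin n × Fin n)
pairs n = filter (uncurry Fin._<?_) (cartesianProduct (allFin n) (allFin n))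

wiener : ∀ {n} (G : Graph n) → Connected G → Poly
wiener {n} G c = foldr _⊕_ [] (map (λ (u , v) → q^ dist G c u v) (pairs n))

Unimodal : (ℕ → ℕ) → Set
Unimodal a = ∃ λ j → (∀ i → i < j → a i ≤ a (suc i)) × (∀ i → j ≤ i → a (suc i) ≤ a i)

IsMaximumAt : (ℕ → ℕ) → ℕ → Set
IsMaximumAt a j = ∀ i → a i ≤ a j

WeaklyIncreasingUpTo : (ℕ → ℕ) → ℕ → Set
WeaklyIncreasingUpTo a m = ∀ i → i < m → a i ≤ a (suc i)

length≤1 : ∀ {A : Set} {c : A} {xs} → Unique xs → All (_≡ c) xs → length xs ≤ 1
length≤1 []              []              = z≤n
length≤1 (_ ∷ [])        (_ ∷ [])        = s≤s z≤n
length≤1 ((x≢y ∷ _) ∷ _) (x≡c ∷ y≡c ∷ _) with () ← x≢y (trans x≡c (sym y≡c))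

-- attach G p adds a leaf adjacent to p.  The new vertex is the largest one, fromℕ n;
-- the old vertices keep their numbers through inject₁.
module _ {n} (G : Graph n) (p : Fin n) where

  AttachAdj : {x y : Fin (suc n)} → View x → View y → Set
  AttachAdj (‵inj₁ {i = i} _) (‵inj₁ {i = j} _) = Adj G i j
  AttachAdj (‵inj₁ {i = i} _) ‵fromℕ            = i ≡ p
  AttachAdj ‵fromℕ            (‵inj₁ {i = j} _) = j ≡ p
  AttachAdj ‵fromℕ            ‵fromℕ            = ⊥

  attachAdj? : ∀ {x y} (s : View x) (t : View y) → Dec (AttachAdj s t)
  attachAdj? (‵inj₁ {i = i} _) (‵inj₁ {i = j} _) = adj? G i j
  attachAdj? (‵inj₁ {i = i} _) ‵fromℕ            = i Fin.≟ p
  attachAdj? ‵fromℕ            (‵inj₁ {i = j} _) = j Fin.≟ p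
  attachAdj? ‵fromℕ            ‵fromℕ            = no λ ()

  attachSym : ∀ {x y} (s : View x) (t : View y) → AttachAdj s t → AttachAdj t s
  attachSym (‵inj₁ _) (‵inj₁ _) a = symm G a
  attachSym (‵inj₁ _) ‵fromℕ    a = a
  attachSym ‵fromℕ    (‵inj₁ _) a = a

  attachIrrefl : ∀ {x} (s : View x) → ¬ AttachAdj s s
  attachIrrefl (‵inj₁ _) a = irrefl G refl a

  attach : Graph (suc n)
  attach = record
    { Adj    = λ x y → AttachAdj (view x) (view y)
    ; adj?   = λ x y → attachAdj? (view x) (view y)
    ; symm   = λ {x} {y} → attachSym (view x) (view y)
    ; irrefl = λ { {x} refl → attachIrrefl (view x) }
    }

  leafNeighbour : ∀ {y} (t : View y) → AttachAdj (‵fromℕ {n}) t → y ≡ inject₁ p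
  leafNeighbour (‵inj₁ _) refl = refl

  degree-leaf : degree attach (fromℕ n) ≤ 1
  degree-leaf = length≤1
    (Unique.filter⁺ (adj? attach (fromℕ n)) (Unique.allFin⁺ (suc n)))
    (All.map (λ {y} a → leafNeighbour (view y)
                (subst (λ s → AttachAdj s (view y)) (view-fromℕ n) a))
             (all-filter (adj? attach (fromℕ n)) (allFin (suc n))))

  attach-connected : Connected G → Connected attach
  attach-connected c x y = go (view x) (view y)
    where
    lift : ∀ {u v k} → Walk G u v k → Walk attach (inject₁ u) (inject₁ v) k
    lift nil = nil
    lift (cons {u} {w} a p) = cons adj (lift p)
      where
      adj : Adj attach (inject₁ u) (inject₁ w)
      adj rewrite view-inject₁ u | view-inject₁ w = a

    down : Adj attach (fromℕ n) (inject₁ p)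
    down rewrite view-fromℕ n | view-inject₁ p = refl

    snoc : ∀ {u v w k} → Walk attach u v k → Adj attach v w → Walk attach u w (suc k)
    snoc nil        b = cons b nil
    snoc (cons a p) b = cons a (snoc p b)

    up : Adj attach (inject₁ p) (fromℕ n)
    up = symm attach {fromℕ n} {inject₁ p} down

    go : ∀ {x y} → View x → View y → ∃ (Walk attach x y)
    go (‵inj₁ {i = i} _) (‵inj₁ {i = j} _) = _ , lift (proj₂ (c i j))
    go (‵inj₁ {i = i} _) ‵fromℕ            = _ , snoc (lift (proj₂ (c i p))) up
    go ‵fromℕ            (‵inj₁ {i = j} _) = _ , cons down (lift (proj₂ (c p j)))
    go ‵fromℕ            ‵fromℕ            = _ , nil

edgeless : ∀ n → Graph n
edgeless n = record
  { Adj = λ _ _ → ⊥ ; adj? = λ _ _ → no λ () ; symm = λ () ; irrefl = λ _ () }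

module _ (d : ℕ) .{{_ : NonTrivial d}} where

  -- dendrimer⁺ m is D_{m+1,d}; its vertex numbered i (1 ≤ i ≤ m + 1) is
  -- the element i ∸ 1 of Fin (suc m).
  dendrimer⁺ : ∀ m → Graph (suc m)

  -- The most recently attached vertex has degree at most 1, so a vertex to
  -- attach the next leaf to always exists.
  free : ∀ m → ∃ λ v → degree (dendrimer⁺ m) v ≤ d

  attachmentPoint : ∀ m → ∃ λ v → degree (dendrimer⁺ m) v ≤ d
                                × (∀ u → u Fin.< v → ¬ degree (dendrimer⁺ m) u ≤ d)

  dendrimer⁺ zero    = edgeless 1
  dendrimer⁺ (suc m) = attach (dendrimer⁺ m) (proj₁ (attachmentPoint m))

  free zero    = zero , z≤n
  free (suc m) = fromℕ (suc m) ,
    ≤-trans (degree-leaf (dendrimer⁺ m) (proj₁ (attachmentPoint m)))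
            (≤-trans (n≤1+n 1) (nonTrivial⇒n>1 d))

  attachmentPoint m =
    least-Fin (λ v → degree (dendrimer⁺ m) v ≤? d) (proj₁ (free m)) (proj₂ (free m))

  dendrimer⁺-connected : ∀ m → Connected (dendrimer⁺ m)
  dendrimer⁺-connected zero    zero zero = 0 , nil
  dendrimer⁺-connected (suc m) = attach-connected _ _ (dendrimer⁺-connected m)

  -- The value at n = 0 is a dummy.
  dendrimer : ∀ n → Graph n
  dendrimer zero    = edgeless 0
  dendrimer (suc m) = dendrimer⁺ m

  dendrimer-connected : ∀ n → Connected (dendrimer n)
  dendrimer-connected zero    ()
  dendrimer-connected (suc m) = dendrimer⁺-connected m

  W : ℕ → Poly
  W n = wiener (dendrimer n) (dendrimer-connected n)

  private instance
    d∸1-nonZero : NonZero (d ∸ 1)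
    d∸1-nonZero = >-nonZero (m<n⇒0<n∸m (nonTrivial⇒n>1 d))

  -- The division is exact.
  geometric : ℕ → ℕ
  geometric k = (d ^ k ∸ 1) / (d ∸ 1)

  nₖ : ℕ → ℕ
  nₖ k = 2 + (d + 1) * geometric k

  mₖ : ℕ → ℕ
  mₖ k = 3 + 2 * d * geometric k

  pₖ : ℕ → ℕ
  pₖ k = mₖ k + 2 * d ^ k ∸ 1

{-# OPTIONS --safe #-}
module Submission where

-- Let c_i(v) be the number of vertices u < v at distance i from v, so that
-- [q^i] W(D_n) = Σ_{v < n} c_i(v).  Let v be the x-th vertex (from 0) of level
-- k + 1.  The vertices of smaller level contribute d^(⌈i/2⌉ - 1) to c_i(v) for
-- 1 ≤ i ≤ 2k + 1 and nothing beyond, and the earlier vertices of the level of v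
-- have even distance to v.  Hence c_1(v) ≤ … ≤ c_{2k+1}(v) = d^k, while
-- c_{2k+2}(v) = d^k ⌊x / d^k⌋ counts the vertices in the preceding branches of
-- the root.  Summing over v, the coefficients increase up to degree 2k as long
-- as level k + 1 is being filled, the last coefficient overtakes its
-- predecessor exactly when the third branch is complete (n = p_k), and at that
-- moment [q^{2k}] W = 2 (d + 1) d^{2k-1} ≤ 3 d^{2k} = [q^{2k+1}] W for k ≥ 1.

open import Defs
open import Data.Nat
open import Data.Nat.Properties
open import Data.Nat.DivMod
open import Data.Nat.Divisibility using (divides-refl)
open import Data.Nat.Induction using (<-rec)
open import Data.Nat.ListAction using (sum)
open import Data.Nat.ListAction.Properties using (sum-++)
open import Data.Nat.Tactic.RingSolver using (solve-∀)
open import Data.Fin as Fin using (Fin; toℕ; fromℕ<)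
import Data.Fin.Properties as Fin
open import Data.Fin.Relation.Unary.Top using (View; view; ‵fromℕ; ‵inj₁)
open import Data.List using ([]; _∷_; _++_; map; filter; foldr; length; tabulate; allFin; cartesianProduct)
open import Data.List.Properties using (map-tabulate; map-∘; map-++)
open import Data.Product using (∃; _×_; _,_; proj₁; proj₂; uncurry)
open import Data.Sum using (_⊎_; inj₁; inj₂; swap; [_,_]′)
open import Function using (_∘_; id; _⇔_; mk⇔; Equivalence)
open import Level using (0ℓ)
open import Relation.Binary using (tri<; tri≈; tri>)
open import Relation.Binary.PropositionalEquality
open import Relation.Nullary using (¬_; Dec; yes; no; contradiction)
open import Relation.Unary using (Pred; Decidable)

-- Finite sums

∑ : ℕ → (ℕ → ℕ) → ℕ
∑ zero    f = 0
∑ (suc n) f = ∑ n f + f n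

∑-cong : ∀ n {f g} → (∀ i → i < n → f i ≡ g i) → ∑ n f ≡ ∑ n g
∑-cong zero    f≡g = refl
∑-cong (suc n) f≡g = cong₂ _+_ (∑-cong n λ i i<n → f≡g i (m<n⇒m<1+n i<n)) (f≡g n ≤-refl)

∑-mono-≤ : ∀ n {f g} → (∀ i → i < n → f i ≤ g i) → ∑ n f ≤ ∑ n g
∑-mono-≤ zero    f≤g = z≤n
∑-mono-≤ (suc n) f≤g = +-mono-≤ (∑-mono-≤ n λ i i<n → f≤g i (m<n⇒m<1+n i<n)) (f≤g n ≤-refl)

∑-+ : ∀ m n f → ∑ (m + n) f ≡ ∑ m f + ∑ n (λ i → f (m + i))
∑-+ m zero    f = trans (cong (λ l → ∑ l f) (+-identityʳ m)) (sym (+-identityʳ _))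
∑-+ m (suc n) f = begin
  ∑ (m + suc n) f                              ≡⟨ cong (λ l → ∑ l f) (+-suc m n) ⟩
  ∑ (m + n) f + f (m + n)                      ≡⟨ cong (_+ f (m + n)) (∑-+ m n f) ⟩
  ∑ m f + ∑ n (λ i → f (m + i)) + f (m + n)    ≡⟨ +-assoc (∑ m f) _ _ ⟩
  ∑ m f + ∑ (suc n) (λ i → f (m + i))          ∎
  where open ≡-Reasoning

∑-distrib-+ : ∀ n f g → ∑ n (λ i → f i + g i) ≡ ∑ n f + ∑ n g
∑-distrib-+ zero    f g = refl
∑-distrib-+ (suc n) f g rewrite ∑-distrib-+ n f g = interchange (∑ n f) (∑ n g) (f n) (g n)
  where
  interchange : ∀ a b c e → a + b + (c + e) ≡ a + c + (b + e)
  interchange = solve-∀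

*-distribˡ-∑ : ∀ c n f → ∑ n (λ i → c * f i) ≡ c * ∑ n f
*-distribˡ-∑ c zero    f = sym (*-zeroʳ c)
*-distribˡ-∑ c (suc n) f rewrite *-distribˡ-∑ c n f = sym (*-distribˡ-+ c (∑ n f) (f n))

∑-const : ∀ n c → ∑ n (λ _ → c) ≡ n * c
∑-const zero    c = refl
∑-const (suc n) c rewrite ∑-const n c = +-comm (n * c) c

∑-zero : ∀ n {f} → (∀ i → i < n → f i ≡ 0) → ∑ n f ≡ 0
∑-zero n f≡0 = trans (∑-cong n f≡0) (trans (∑-const n 0) (*-zeroʳ n))

∑-suc : ∀ n f → ∑ (suc n) f ≡ f 0 + ∑ n (f ∘ suc)
∑-suc n f = ∑-+ 1 n f

+-swapʳ : ∀ a b c → a + b + c ≡ a + c + b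
+-swapʳ = solve-∀

-- Adding crosswise confines the difference to the index `x` without truncated subtraction. Later
-- `x` is a vertex within its own level, the one exception to the distance formula there.
∑-replace : ∀ n {f g x} → x < n → (∀ i → i < n → i ≢ x → f i ≡ g i) → ∑ n f + g x ≡ ∑ n g + f x
∑-replace (suc n) {f} {g} {x} x<1+n f≡g with n ≟ x
... | yes refl = begin
  ∑ n f + f n + g n  ≡⟨ cong (λ s → s + f n + g n) (∑-cong n λ i i<n → f≡g i (m<n⇒m<1+n i<n) (<⇒≢ i<n)) ⟩
  ∑ n g + f n + g n  ≡⟨ +-swapʳ (∑ n g) (f n) (g n) ⟩
  ∑ n g + g n + f n  ∎
  where open ≡-Reasoning
... | no n≢x = begin
  ∑ n f + f n + g x    ≡⟨ +-swapʳ (∑ n f) (f n) (g x) ⟩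
  ∑ n f + g x + f n    ≡⟨ cong₂ _+_ (∑-replace n x<n λ i i<n → f≡g i (m<n⇒m<1+n i<n)) (f≡g n ≤-refl n≢x) ⟩
  ∑ n g + f x + g n    ≡⟨ +-swapʳ (∑ n g) (f x) (g n) ⟩
  ∑ n g + g n + f x    ∎
  where
  open ≡-Reasoning
  x<n : x < n
  x<n = ≤∧≢⇒< (s≤s⁻¹ x<1+n) (n≢x ∘ sym)

[q*d+r]/d : ∀ q {r d} .{{_ : NonZero d}} → r < d → (q * d + r) / d ≡ q
[q*d+r]/d q {r} {d} r<d = begin
  (q * d + r) / d      ≡⟨ +-distrib-/-∣ˡ r (divides-refl q) ⟩
  q * d / d + r / d    ≡⟨ cong₂ _+_ (m*n/n≡m q d) (m<n⇒m/n≡0 r<d) ⟩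
  q + 0                ≡⟨ +-identityʳ q ⟩
  q                    ∎
  where open ≡-Reasoning

∑-partial-block : ∀ d .{{_ : NonZero d}} q {r} → r ≤ d → ∀ f →
                  ∑ (q * d + r) (λ x → f (x / d)) ≡ ∑ (q * d) (λ x → f (x / d)) + r * f q
∑-partial-block d q {r} r≤d f = begin
  ∑ (q * d + r) (λ x → f (x / d))                                        ≡⟨ ∑-+ (q * d) r _ ⟩
  ∑ (q * d) (λ x → f (x / d)) + ∑ r (λ x → f ((q * d + x) / d))
    ≡⟨ cong (∑ (q * d) _ +_) (∑-cong r λ x x<r → cong f ([q*d+r]/d q (<-≤-trans x<r r≤d))) ⟩
  ∑ (q * d) (λ x → f (x / d)) + ∑ r (λ _ → f q)
    ≡⟨ cong (∑ (q * d) _ +_) (∑-const r (f q)) ⟩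
  ∑ (q * d) (λ x → f (x / d)) + r * f q                                  ∎
  where open ≡-Reasoning

∑-blocks : ∀ d .{{_ : NonZero d}} q f → ∑ (q * d) (λ x → f (x / d)) ≡ d * ∑ q f
∑-blocks d zero    f = sym (*-zeroʳ d)
∑-blocks d (suc q) f = begin
  ∑ (d + q * d) (λ x → f (x / d))            ≡⟨ cong (λ l → ∑ l (λ x → f (x / d))) (+-comm d (q * d)) ⟩
  ∑ (q * d + d) (λ x → f (x / d))            ≡⟨ ∑-partial-block d q ≤-refl f ⟩
  ∑ (q * d) (λ x → f (x / d)) + d * f q      ≡⟨ cong (_+ d * f q) (∑-blocks d q f) ⟩
  d * ∑ q f + d * f q                        ≡⟨ *-distribˡ-+ d (∑ q f) (f q) ⟨
  d * ∑ (suc q) f                            ∎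
  where open ≡-Reasoning

-- Siblings are numbered in blocks of length `d`, so this turns sums over vertices into sums over
-- parents; the last family has only `n % d` members.
∑-/ : ∀ d .{{_ : NonZero d}} n f → ∑ n (λ x → f (x / d)) ≡ d * ∑ (n / d) f + (n % d) * f (n / d)
∑-/ d n f = begin
  ∑ n (λ x → f (x / d))                                       ≡⟨ cong (λ l → ∑ l (λ x → f (x / d))) n≡ ⟩
  ∑ (n / d * d + n % d) (λ x → f (x / d))                     ≡⟨ ∑-partial-block d (n / d) (m%n≤n n d) f ⟩
  ∑ (n / d * d) (λ x → f (x / d)) + n % d * f (n / d)
    ≡⟨ cong (_+ n % d * f (n / d)) (∑-blocks d (n / d) f) ⟩
  d * ∑ (n / d) f + n % d * f (n / d)                         ∎
  where
  open ≡-Reasoning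
  n≡ : n ≡ n / d * d + n % d
  n≡ = trans (m≡m%n+[m/n]*n n d) (+-comm (n % d) _)

-- The first three blocks consist of `b` terms 0, 1 and 2 each. The surplus of the last makes up for
-- the deficit of the first only at its end, when `x = 3 * b`.
∑-/-≤ : ∀ b .{{_ : NonZero b}} {x} → x ≤ 3 * b → ∑ x (_/ b) ≤ x
∑-/-≤ b {x} x≤3b = begin
  ∑ x (_/ b)                          ≡⟨ ∑-/ b x (λ w → w) ⟩
  b * ∑ q (λ w → w) + r * q           ≤⟨ bound q r q≤3 (m%n≤n x b) (subst (_≤ 3 * b) x≡ x≤3b) ⟩
  r + q * b                           ≡⟨ x≡ ⟨
  x                                   ∎
  where
  open ≤-Reasoning
  q = x / b
  r = x % b
  x≡ : x ≡ r + q * b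
  x≡ = m≡m%n+[m/n]*n x b
  q≤3 : q ≤ 3
  q≤3 = ≤-trans (/-monoˡ-≤ b x≤3b) (≤-reflexive (m*n/n≡m 3 b))
  bound : ∀ q r → q ≤ 3 → r ≤ b → r + q * b ≤ 3 * b → b * ∑ q (λ w → w) + r * q ≤ r + q * b
  bound 0 r _ _ _ rewrite *-zeroʳ b | *-zeroʳ r = z≤n
  bound 1 r _ _ _ rewrite *-zeroʳ b | *-identityʳ r = m≤m+n r _
  bound 2 r _ r≤b _ = begin
    b * 1 + r * 2        ≡⟨ eq b r ⟩
    r + (b + r)          ≤⟨ +-monoʳ-≤ r (+-monoʳ-≤ b r≤b) ⟩
    r + (b + b)          ≡⟨ cong (λ c → r + (b + c)) (+-identityʳ b) ⟨
    r + 2 * b            ∎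
    where
    eq : ∀ b r → b * 1 + r * 2 ≡ r + (b + r)
    eq = solve-∀
  -- A quotient of 3 occurs only at `x = 3 * b`, where the remainder is 0 and both sides agree.
  bound 3 r _ _ r+3b≤3b with refl ← n≤0⇒n≡0 (+-cancelʳ-≤ (3 * b) r 0 r+3b≤3b) =
    ≤-reflexive (trans (+-identityʳ _) (*-comm b 3))
  bound (suc (suc (suc (suc _)))) r (s≤s (s≤s (s≤s ())))

-- The first three blocks sum to exactly `3 * b`, and every later term is at least 1.
∑-/-≥ : ∀ b .{{_ : NonZero b}} {x} → 3 * b ≤ x → x ≤ ∑ x (_/ b)
∑-/-≥ b {x} 3b≤x with x ∸ 3 * b | m+[n∸m]≡n 3b≤x
... | z | refl = begin
  3 * b + z
    ≡⟨ cong₂ _+_ (*-comm 3 b) (sym (trans (∑-const z 1) (*-identityʳ z))) ⟩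
  b * 3 + ∑ z (λ _ → 1)
    ≤⟨ +-monoʳ-≤ (b * 3) (∑-mono-≤ z λ i _ → m≥n⇒m/n>0 (≤-trans (m≤m+n b (2 * b)) (m≤m+n (3 * b) i))) ⟩
  b * 3 + ∑ z (λ i → (3 * b + i) / b)
    ≡⟨ cong (_+ ∑ z (λ i → (3 * b + i) / b)) (∑-blocks b 3 (λ w → w)) ⟨
  ∑ (3 * b) (_/ b) + ∑ z (λ i → (3 * b + i) / b)         ≡⟨ ∑-+ (3 * b) z (_/ b) ⟨
  ∑ (3 * b + z) (_/ b)                                   ∎
  where open ≤-Reasoning

∑-% : ∀ b .{{_ : NonZero b}} q f → ∑ (q * b) (λ w → f (w % b)) ≡ q * ∑ b f
∑-% b zero    f = refl
∑-% b (suc q) f = begin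
  ∑ (b + q * b) (λ w → f (w % b))
    ≡⟨ cong (λ n → ∑ n (λ w → f (w % b))) (+-comm b (q * b)) ⟩
  ∑ (q * b + b) (λ w → f (w % b))                              ≡⟨ ∑-+ (q * b) b _ ⟩
  ∑ (q * b) (λ w → f (w % b)) + ∑ b (λ w → f ((q * b + w) % b))
    ≡⟨ cong₂ _+_ (∑-% b q f) (∑-cong b λ w w<b → cong f (trans (cong (_% b) (+-comm (q * b) w)) (trans ([m+kn]%n≡m%n w q b) (m<n⇒m%n≡m w<b)))) ⟩
  q * ∑ b f + ∑ b f                                            ≡⟨ +-comm (q * ∑ b f) _ ⟩
  suc q * ∑ b f                                                ∎
  where open ≡-Reasoning

triangular : ℕ → ℕ
triangular n = ∑ n suc

∑-id : ∀ n → ∑ (suc n) (λ w → w) ≡ triangular n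
∑-id n = ∑-suc n (λ w → w)

2*triangular : ∀ n → 2 * triangular n ≡ suc n * n
2*triangular zero    = refl
2*triangular (suc n) = begin
  2 * (triangular n + suc n)       ≡⟨ *-distribˡ-+ 2 (triangular n) (suc n) ⟩
  2 * triangular n + 2 * suc n     ≡⟨ cong (_+ 2 * suc n) (2*triangular n) ⟩
  suc n * n + 2 * suc n            ≡⟨ eq n ⟩
  suc (suc n) * suc n              ∎
  where
  open ≡-Reasoning
  eq : ∀ n → suc n * n + 2 * suc n ≡ suc (suc n) * suc n
  eq = solve-∀

-- Coefficients as counts

-- By recursion on both arguments, one step of a path cancels against one unit of the exponent by
-- computation.
δ : ℕ → ℕ → ℕ
δ zero    zero    = 1
δ zero    (suc _) = 0
δ (suc _) zero    = 0
δ (suc m) (suc n) = δ m n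

δ-refl : ∀ n → δ n n ≡ 1
δ-refl zero    = refl
δ-refl (suc n) = δ-refl n

δ-≢ : ∀ {m n} → m ≢ n → δ m n ≡ 0
δ-≢ {zero}  {zero}  m≢n = contradiction refl m≢n
δ-≢ {zero}  {suc n} m≢n = refl
δ-≢ {suc m} {zero}  m≢n = refl
δ-≢ {suc m} {suc n} m≢n = δ-≢ (m≢n ∘ cong suc)

δ-sym : ∀ m n → δ m n ≡ δ n m
δ-sym zero    zero    = refl
δ-sym zero    (suc n) = refl
δ-sym (suc m) zero    = refl
δ-sym (suc m) (suc n) = δ-sym m n

∑-δ-∉ : ∀ {n x} → n ≤ x → ∑ n (δ x) ≡ 0
∑-δ-∉ {n} n≤x = ∑-zero n λ i i<n → δ-≢ (>⇒≢ (<-≤-trans i<n n≤x))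

∑-δ-∈ : ∀ {n x} → x < n → ∑ n (δ x) ≡ 1
∑-δ-∈ {n} {x} x<n = begin
  ∑ n (δ x)                  ≡⟨ +-identityʳ _ ⟨
  ∑ n (δ x) + 0              ≡⟨ ∑-replace n {g = λ _ → 0} x<n (λ i _ i≢x → δ-≢ (i≢x ∘ sym)) ⟩
  ∑ n (λ _ → 0) + δ x x      ≡⟨ cong₂ _+_ (∑-zero n λ _ _ → refl) (δ-refl x) ⟩
  1                          ∎
  where open ≡-Reasoning

𝟙 : ∀ {A : Set} → Dec A → ℕ
𝟙 (yes _) = 1
𝟙 (no _)  = 0

𝟙-yes : ∀ {A : Set} (a? : Dec A) → A → 𝟙 a? ≡ 1
𝟙-yes (yes _) _ = refl
𝟙-yes (no ¬a) a = contradiction a ¬a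

𝟙-no : ∀ {A : Set} (a? : Dec A) → ¬ A → 𝟙 a? ≡ 0
𝟙-no (yes a) ¬a = contradiction a ¬a
𝟙-no (no _)  _  = refl

-- Enlarging the square adds the row `u = n`, which has no `v > n`, and the column `v = n`, which is
-- the new inner sum. This groups the pairs by their later vertex.
∑-triangle : ∀ n (g : ℕ → ℕ → ℕ) →
             ∑ n (λ u → ∑ n (λ v → 𝟙 (u <? v) * g u v)) ≡ ∑ n (λ v → ∑ v (λ u → g u v))
∑-triangle zero    g = refl
∑-triangle (suc n) g = begin
  ∑ n (λ u → ∑ n (h u) + h u n) + ∑ (suc n) (h n)
    ≡⟨ cong₂ _+_ (∑-distrib-+ n (λ u → ∑ n (h u)) (λ u → h u n))
                 (∑-zero (suc n) {h n} λ v v≤n → cong (_* g n v) (𝟙-no (n <? v) (≤⇒≯ (s≤s⁻¹ v≤n)))) ⟩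
  ∑ n (λ u → ∑ n (h u)) + ∑ n (λ u → h u n) + 0
    ≡⟨ +-identityʳ _ ⟩
  ∑ n (λ u → ∑ n (h u)) + ∑ n (λ u → h u n)
    ≡⟨ cong₂ _+_ (∑-triangle n g)
         (∑-cong n λ u u<n → trans (cong (_* g u n) (𝟙-yes (u <? n) u<n)) (*-identityˡ _)) ⟩
  ∑ n (λ v → ∑ v (λ u → g u v)) + ∑ n (λ u → g u n)  ∎
  where
  open ≡-Reasoning
  h : ℕ → ℕ → ℕ
  h u v = 𝟙 (u <? v) * g u v

sum-tabulate : ∀ n {f : Fin n → ℕ} {g} → (∀ i → f i ≡ g (toℕ i)) → sum (tabulate f) ≡ ∑ n g
sum-tabulate zero    f≡g = refl
sum-tabulate (suc n) {g = g} f≡g =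
  trans (cong₂ _+_ (f≡g Fin.zero) (sum-tabulate n (f≡g ∘ Fin.suc))) (sym (∑-suc n g))

sum-map-allFin : ∀ n {f : Fin n → ℕ} {g} → (∀ i → f i ≡ g (toℕ i)) → sum (map f (allFin n)) ≡ ∑ n g
sum-map-allFin n {f} f≡g = trans (cong sum (map-tabulate id f)) (sum-tabulate n f≡g)

sum-map-filter : ∀ {A : Set} {P : Pred A 0ℓ} (P? : Decidable P) f xs →
                 sum (map f (filter P? xs)) ≡ sum (map (λ x → 𝟙 (P? x) * f x) xs)
sum-map-filter P? f []       = refl
sum-map-filter P? f (x ∷ xs) with P? x
... | yes _ = cong₂ _+_ (sym (*-identityˡ (f x))) (sum-map-filter P? f xs)
... | no _  = sum-map-filter P? f xs

length-filter-𝟙 : ∀ {A : Set} {P : Pred A 0ℓ} (P? : Decidable P) xs →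
                  length (filter P? xs) ≡ sum (map (λ x → 𝟙 (P? x)) xs)
length-filter-𝟙 P? []       = refl
length-filter-𝟙 P? (x ∷ xs) with P? x
... | yes _ = cong suc (length-filter-𝟙 P? xs)
... | no _  = length-filter-𝟙 P? xs

sum-map-cartesianProduct : ∀ {A B : Set} (f : A × B → ℕ) xs ys →
  sum (map f (cartesianProduct xs ys)) ≡ sum (map (λ x → sum (map (λ y → f (x , y)) ys)) xs)
sum-map-cartesianProduct f []       ys = refl
sum-map-cartesianProduct f (x ∷ xs) ys = begin
  sum (map f (map (x ,_) ys ++ cartesianProduct xs ys))
    ≡⟨ cong sum (map-++ f (map (x ,_) ys) _) ⟩
  sum (map f (map (x ,_) ys) ++ map f (cartesianProduct xs ys))
    ≡⟨ sum-++ (map f (map (x ,_) ys)) _ ⟩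
  sum (map f (map (x ,_) ys)) + sum (map f (cartesianProduct xs ys))
    ≡⟨ cong₂ _+_ (cong sum (sym (map-∘ ys))) (sum-map-cartesianProduct f xs ys) ⟩
  sum (map (λ y → f (x , y)) ys) + sum (map (λ x → sum (map (λ y → f (x , y)) ys)) xs)  ∎
  where open ≡-Reasoning

coeff-⊕ : ∀ i f g → [q^ i ] (f ⊕ g) ≡ [q^ i ] f + [q^ i ] g
coeff-⊕ i       []      g       = refl
coeff-⊕ zero    (a ∷ f) []      = sym (+-identityʳ a)
coeff-⊕ (suc i) (a ∷ f) []      = sym (+-identityʳ _)
coeff-⊕ zero    (a ∷ f) (b ∷ g) = refl
coeff-⊕ (suc i) (a ∷ f) (b ∷ g) = coeff-⊕ i f g

coeff-q^ : ∀ i k → [q^ i ] (q^ k) ≡ δ k i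
coeff-q^ zero    zero    = refl
coeff-q^ (suc i) zero    = refl
coeff-q^ zero    (suc k) = refl
coeff-q^ (suc i) (suc k) = coeff-q^ i k

coeff-foldr-⊕ : ∀ {A : Set} i (h : A → Poly) xs →
                [q^ i ] (foldr _⊕_ [] (map h xs)) ≡ sum (map (λ x → [q^ i ] (h x)) xs)
coeff-foldr-⊕ i h []       = refl
coeff-foldr-⊕ i h (x ∷ xs) = trans (coeff-⊕ i (h x) _) (cong ([q^ i ] (h x) +_) (coeff-foldr-⊕ i h xs))

coeff-wiener : ∀ {n} (G : Graph n) c (D : ℕ → ℕ → ℕ) → (∀ u v → dist G c u v ≡ D (toℕ u) (toℕ v)) →
               ∀ i → [q^ i ] (wiener G c) ≡ ∑ n (λ v → ∑ v (λ u → δ (D u v) i))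
coeff-wiener {n} G c D dist≡D i = begin
  [q^ i ] (wiener G c)
    ≡⟨ coeff-foldr-⊕ i _ (pairs n) ⟩
  sum (map (λ (u , v) → [q^ i ] (q^ dist G c u v)) (pairs n))
    ≡⟨ sum-map-filter (uncurry Fin._<?_) _ (cartesianProduct (allFin n) (allFin n)) ⟩
  sum (map (λ (u , v) → 𝟙 (u Fin.<? v) * [q^ i ] (q^ dist G c u v)) (cartesianProduct (allFin n) (allFin n)))
    ≡⟨ sum-map-cartesianProduct _ (allFin n) (allFin n) ⟩
  sum (map (λ u → sum (map (λ v → 𝟙 (u Fin.<? v) * [q^ i ] (q^ dist G c u v)) (allFin n))) (allFin n))
    ≡⟨ sum-map-allFin n (λ u → sum-map-allFin n λ v →
         cong (𝟙 (u Fin.<? v) *_) (trans (coeff-q^ i (dist G c u v)) (cong (λ k → δ k i) (dist≡D u v)))) ⟩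
  ∑ n (λ u → ∑ n (λ v → 𝟙 (u <? v) * δ (D u v) i))
    ≡⟨ ∑-triangle n (λ u v → δ (D u v) i) ⟩
  ∑ n (λ v → ∑ v (λ u → δ (D u v) i))
    ∎
  where open ≡-Reasoning

-- The dendrimer as a parent function and its distances

snoc : ∀ {n} {G : Graph n} {u v w k} → Walk G u v k → Adj G v w → Walk G u w (suc k)
snoc nil        b = cons b nil
snoc (cons a p) b = cons a (snoc p b)

dist-unique : ∀ {n} (G : Graph n) c {u v k} → Walk G u v k → (∀ {j} → Walk G u v j → k ≤ j) → dist G c u v ≡ k
dist-unique G c {u} {v} {k} p shortest
  with least-ℕ (walk? G u v) (proj₁ (c u v)) (proj₂ (c u v))
... | m , pm , min = ≤-antisym (≮⇒≥ λ k<m → min k k<m p) (shortest pm)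

module Tree (d : ℕ) .{{_ : NonTrivial d}} where

  private instance
    d-nonZero : NonZero d
    d-nonZero = nonTrivial⇒nonZero d

  -- Vertices are numbered from 0, so the children of 0 are 1, …, d + 1 and
  -- those of v > 0 are d v + 2, …, d v + d + 1.  The value at 0 is a dummy.
  par : ℕ → ℕ
  par v = (v ∸ 2) / d

  par-< : ∀ {v} → 0 < v → par v < v
  par-< {suc v} _ = s≤s (≤-trans (m/n≤m (suc v ∸ 2) d) (m∸n≤m v 1))

  Child : ℕ → ℕ → Set
  Child x y = 0 < y × x ≡ par y

  Edge : ℕ → ℕ → Set
  Edge x y = Child x y ⊎ Child y x

  child-< : ∀ {x y} → Child x y → x < y
  child-< (0<y , refl) = par-< 0<y

  -- A parent has a smaller number than its child, so the larger of two distinct vertices is no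
  -- ancestor of the smaller, and the path leaves it through its parent. The 0 for exhausted fuel is
  -- a dummy.
  distance′ : ℕ → ℕ → ℕ → ℕ
  distance′ zero       u v = 0
  distance′ (suc fuel) u v with <-cmp u v
  ... | tri< _ _ _ = suc (distance′ fuel u (par v))
  ... | tri≈ _ _ _ = 0
  ... | tri> _ _ _ = suc (distance′ fuel (par u) v)

  stepʳ : ∀ {u v} → u < v → u + par v < u + v
  stepʳ {u} u<v = +-monoʳ-< u (par-< (≤-<-trans z≤n u<v))

  stepˡ : ∀ {u v} → v < u → par u + v < u + v
  stepˡ {u} {v} v<u = +-monoˡ-< v (par-< (≤-<-trans z≤n v<u))

  distance′-fuel : ∀ f g u v → u + v < f → u + v < g → distance′ f u v ≡ distance′ g u v
  distance′-fuel (suc f) (suc g) u v u+v<f u+v<g with <-cmp u v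
  ... | tri< u<v _ _ = cong suc (distance′-fuel f g u (par v)
                                  (<-≤-trans (stepʳ u<v) (s≤s⁻¹ u+v<f)) (<-≤-trans (stepʳ u<v) (s≤s⁻¹ u+v<g)))
  ... | tri≈ _ _ _   = refl
  ... | tri> _ _ v<u = cong suc (distance′-fuel f g (par u) v
                                  (<-≤-trans (stepˡ v<u) (s≤s⁻¹ u+v<f)) (<-≤-trans (stepˡ v<u) (s≤s⁻¹ u+v<g)))

  abstract

    -- The fuel u + v + 1 suffices, as every step decreases u + v.
    distance : ℕ → ℕ → ℕ
    distance u v = distance′ (suc (u + v)) u v

    distance-refl : ∀ u → distance u u ≡ 0
    distance-refl u with <-cmp u u
    ... | tri< u<u _ _ = contradiction u<u (<-irrefl refl)
    ... | tri≈ _ _ _   = refl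
    ... | tri> _ _ u<u = contradiction u<u (<-irrefl refl)

    distance-< : ∀ {u v} → u < v → distance u v ≡ suc (distance u (par v))
    distance-< {u} {v} u<v with <-cmp u v
    ... | tri< _ _ _   = cong suc (distance′-fuel (u + v) (suc (u + par v)) u (par v) (stepʳ u<v) ≤-refl)
    ... | tri≈ ¬< _ _  = contradiction u<v ¬<
    ... | tri> ¬< _ _  = contradiction u<v ¬<

    distance-> : ∀ {u v} → v < u → distance u v ≡ suc (distance (par u) v)
    distance-> {u} {v} v<u with <-cmp u v
    ... | tri< _ _ ¬>  = contradiction v<u ¬>
    ... | tri≈ _ _ ¬>  = contradiction v<u ¬>
    ... | tri> _ _ _   = cong suc (distance′-fuel (u + v) (suc (par u + v)) (par u) v (stepˡ v<u) ≤-refl)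

  -- Induction on `v`. For `v > u` both distances start with the same step from `v` to `par v`; for
  -- `v < u` the first one starts with the step to `par u`; at `v = u` they are 0 and 1.
  distance-par : ∀ {u} → 0 < u → ∀ v →
                 distance u v ≤ suc (distance (par u) v) × distance (par u) v ≤ suc (distance u v)
  distance-par {u} 0<u = <-rec _ go
    where
    go : ∀ v → (∀ {w} → w < v →
           distance u w ≤ suc (distance (par u) w) × distance (par u) w ≤ suc (distance u w)) →
         distance u v ≤ suc (distance (par u) v) × distance (par u) v ≤ suc (distance u v)
    go v rec with <-cmp u v
    ... | tri≈ _ refl _ rewrite distance-< (par-< 0<u) | distance-refl u | distance-refl (par u) = z≤n , ≤-refl
    ... | tri> _ _ v<u  rewrite distance-> v<u = ≤-refl , m≤n⇒m≤1+n (n≤1+n _)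
    ... | tri< u<v _ _
      rewrite distance-< u<v | distance-< (<-trans (par-< 0<u) u<v)
      with rec (par-< (≤-<-trans z≤n u<v))
    ...   | le , ge = s≤s le , s≤s ge

  distance-edge : ∀ {u w} → Edge u w → ∀ v → distance u v ≤ suc (distance w v)
  distance-edge (inj₁ (0<w , refl)) v = proj₂ (distance-par 0<w v)
  distance-edge (inj₂ (0<u , refl)) v = proj₁ (distance-par 0<u v)

  -- `G` is the part on the first `n` vertices of the infinite tree given by `par`.
  Realises : ∀ {n} → Graph n → Set
  Realises G = ∀ x y → Adj G x y ⇔ Edge (toℕ x) (toℕ y)

  module _ {n} (G : Graph n) (G-edges : Realises G) where

    open Equivalence

    walk-distance : ∀ f u v .(u<n : u < n) .(v<n : v < n) → u + v < f →
                    Walk G (fromℕ< u<n) (fromℕ< v<n) (distance u v)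
    walk-distance (suc f) u v u<n v<n u+v<f with <-cmp u v
    ... | tri≈ _ refl _ rewrite distance-refl u = nil
    ... | tri< u<v _ _  rewrite distance-< u<v =
      snoc (walk-distance f u (par v) u<n (<-trans p<v v<n) (<-≤-trans (stepʳ u<v) (s≤s⁻¹ u+v<f)))
           (from (G-edges _ _) (subst₂ Edge (sym (Fin.toℕ-fromℕ< _)) (sym (Fin.toℕ-fromℕ< _)) (inj₁ (0<v , refl))))
      where
      0<v = ≤-<-trans z≤n u<v
      p<v = par-< 0<v
    ... | tri> _ _ v<u  rewrite distance-> v<u =
      cons (from (G-edges _ _) (subst₂ Edge (sym (Fin.toℕ-fromℕ< _)) (sym (Fin.toℕ-fromℕ< _)) (inj₂ (0<u , refl))))
           (walk-distance f (par u) v (<-trans p<u u<n) v<n (<-≤-trans (stepˡ v<u) (s≤s⁻¹ u+v<f)))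
      where
      0<u = ≤-<-trans z≤n v<u
      p<u = par-< 0<u

    -- By `distance-edge`, the distance to a fixed endpoint drops by at most one along each edge.
    distance-shortest : ∀ {x y j} → Walk G x y j → distance (toℕ x) (toℕ y) ≤ j
    distance-shortest {x} nil = ≤-reflexive (distance-refl (toℕ x))
    distance-shortest {y = y} (cons a p) =
      ≤-trans (distance-edge (to (G-edges _ _) a) (toℕ y)) (s≤s (distance-shortest p))

    dist≡distance : ∀ c x y → dist G c x y ≡ distance (toℕ x) (toℕ y)
    dist≡distance c x y = dist-unique G c walk distance-shortest
      where
      walk : Walk G x y (distance (toℕ x) (toℕ y))
      walk = subst₂ (λ a b → Walk G a b (distance (toℕ x) (toℕ y))) (Fin.fromℕ<-toℕ x _) (Fin.fromℕ<-toℕ y _)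
               (walk-distance _ (toℕ x) (toℕ y) (Fin.toℕ<n x) (Fin.toℕ<n y) ≤-refl)

  -- Degrees and the attachment point

  χ : ℕ → ℕ → ℕ
  -- As `par 0` computes to 0, the general clause would make the root its own child.
  χ x zero    = 0
  χ x (suc y) = δ x (par (suc y))

  χ-child : ∀ {x y} → Child x y → χ x y ≡ 1
  χ-child {y = suc y} (_ , refl) = δ-refl (par (suc y))

  χ-¬child : ∀ {x y} → ¬ Child x y → χ x y ≡ 0
  χ-¬child {y = zero}  _  = refl
  χ-¬child {y = suc y} ¬c = δ-≢ λ x≡p → ¬c (z<s , x≡p)

  𝟙-edge : ∀ {A : Set} {x y} (a? : Dec A) → A ⇔ Edge x y → 𝟙 a? ≡ χ x y + χ y x
  𝟙-edge {x = x} {y} (no ¬a) A⇔E = sym (cong₂ _+_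
    (χ-¬child {x} {y} (¬a ∘ Equivalence.from A⇔E ∘ inj₁)) (χ-¬child {y} {x} (¬a ∘ Equivalence.from A⇔E ∘ inj₂)))
  𝟙-edge {x = x} {y} (yes a) A⇔E with Equivalence.to A⇔E a
  ... | inj₁ c = sym (cong₂ _+_ (χ-child c) (χ-¬child {y} {x} (<-asym (child-< c) ∘ child-<)))
  ... | inj₂ c = sym (cong₂ _+_ (χ-¬child {x} {y} (<-asym (child-< c) ∘ child-<)) (χ-child c))

  -- Vertex 1 is the extra child of the root and gives `δ x 0`; from vertex 2 on, siblings come in
  -- blocks of length `d`.
  ∑-χ-children : ∀ m x → ∑ (2 + m) (χ x) ≡ δ x 0 + (d * ∑ (m / d) (δ x) + m % d * δ x (m / d))
  ∑-χ-children m x = begin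
    ∑ (2 + m) (χ x)                       ≡⟨ ∑-+ 2 m (χ x) ⟩
    δ x (0 / d) + ∑ m (λ z → δ x (z / d)) ≡⟨ cong₂ _+_ (cong (δ x) (0/n≡0 d)) (∑-/ d m (δ x)) ⟩
    δ x 0 + (d * ∑ (m / d) (δ x) + m % d * δ x (m / d))  ∎
    where open ≡-Reasoning

  -- The root has no parent; its extra child, the term `δ x 0`, takes that place. Thus the root
  -- obeys the same degree formula as all other vertices.
  ∑-χ-parent : ∀ {n x} → x < n → δ x 0 + ∑ n (λ y → χ y x) ≡ 1
  ∑-χ-parent {n} {zero}  x<n = cong suc (∑-zero n λ _ _ → refl)
  ∑-χ-parent {n} {suc x} x<n =
    trans (∑-cong n λ y _ → δ-sym y (par (suc x))) (∑-δ-∈ (<-trans (par-< z<s) x<n))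

  module _ {m} (G : Graph (2 + m)) (G-edges : Realises G) where

    degree≡ : ∀ x → degree G x ≡ suc (d * ∑ (m / d) (δ (toℕ x)) + m % d * δ (toℕ x) (m / d))
    degree≡ x = begin
      degree G x
        ≡⟨ length-filter-𝟙 (adj? G x) (allFin (2 + m)) ⟩
      sum (map (λ y → 𝟙 (adj? G x y)) (allFin (2 + m)))
        ≡⟨ sum-map-allFin (2 + m) (λ y → 𝟙-edge (adj? G x y) (G-edges x y)) ⟩
      ∑ (2 + m) (λ y → χ (toℕ x) y + χ y (toℕ x))
        ≡⟨ ∑-distrib-+ (2 + m) (χ (toℕ x)) (λ y → χ y (toℕ x)) ⟩
      ∑ (2 + m) (χ (toℕ x)) + ∑ (2 + m) (λ y → χ y (toℕ x))
        ≡⟨ cong (_+ ∑ (2 + m) (λ y → χ y (toℕ x))) (∑-χ-children m (toℕ x)) ⟩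
      δ (toℕ x) 0 + s + ∑ (2 + m) (λ y → χ y (toℕ x))
        ≡⟨ +-swapʳ (δ (toℕ x) 0) s _ ⟩
      δ (toℕ x) 0 + ∑ (2 + m) (λ y → χ y (toℕ x)) + s
        ≡⟨ cong (_+ s) (∑-χ-parent (Fin.toℕ<n x)) ⟩
      suc s  ∎
      where
      open ≡-Reasoning
      s : ℕ
      s = d * ∑ (m / d) (δ (toℕ x)) + m % d * δ (toℕ x) (m / d)

    degree-saturated : ∀ x → toℕ x < m / d → d < degree G x
    degree-saturated x x<q rewrite degree≡ x | ∑-δ-∈ x<q | *-identityʳ d = s≤s (m≤m+n d _)

    degree-unsaturated : ∀ x → toℕ x ≡ m / d → degree G x ≤ d
    degree-unsaturated x x≡q rewrite degree≡ x | x≡q | ∑-δ-∉ {m / d} ≤-refl | δ-refl (m / d)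
                                   | *-zeroʳ d | *-identityʳ (m % d) = m%n<n m d

  -- Among `2 + m` vertices, those below `m / d` have all their children and degree above `d`, while
  -- `m / d` has degree at most `d`. So the least free vertex is `m / d = par (2 + m)`. The degree
  -- formula assumes two vertices, hence the separate first case.
  toℕ-attachmentPoint : ∀ m → Realises (dendrimer⁺ d m) → toℕ (proj₁ (attachmentPoint d m)) ≡ par (suc m)
  toℕ-attachmentPoint zero    _ with proj₁ (attachmentPoint d 0)
  ... | Fin.zero = sym (0/n≡0 d)
  toℕ-attachmentPoint (suc m) G-edges with attachmentPoint d (suc m)
  ... | v , deg≤d , minimal with <-cmp (toℕ v) (m / d)
  ...   | tri< v<q _ _ = contradiction deg≤d (<⇒≱ (degree-saturated (dendrimer⁺ d (suc m)) G-edges v v<q))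
  ...   | tri≈ _ v≡q _ = v≡q
  ...   | tri> _ _ q<v = contradiction
      (degree-unsaturated (dendrimer⁺ d (suc m)) G-edges q toℕ-q)
      (minimal q (subst (_< toℕ v) (sym toℕ-q) q<v))
    where
    q<2+m : m / d < 2 + m
    q<2+m = s≤s (m≤n⇒m≤1+n (m/n≤m m d))
    q = fromℕ< q<2+m
    toℕ-q : toℕ q ≡ m / d
    toℕ-q = Fin.toℕ-fromℕ< q<2+m

  attach-realises : ∀ {n} (G : Graph n) p → Realises G → toℕ p ≡ par n → Realises (attach G p)
  attach-realises {n} G p G-edges p≡ x y = go (view x) (view y)
    where
    0<n : 0 < n
    0<n = ≤-<-trans z≤n (Fin.toℕ<n p)

    leaf : ∀ i → i ≡ p ⇔ Edge (toℕ i) n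
    leaf i = mk⇔ (λ { refl → inj₁ (0<n , p≡) }) λ where
      (inj₁ (_ , i≡)) → Fin.toℕ-injective (trans i≡ (sym p≡))
      (inj₂ c)        → contradiction (child-< c) (<-asym (Fin.toℕ<n i))

    go : ∀ {x y} (s : View x) (t : View y) → AttachAdj G p s t ⇔ Edge (toℕ x) (toℕ y)
    go (‵inj₁ {i = i} _) (‵inj₁ {i = j} _) rewrite Fin.toℕ-inject₁ i | Fin.toℕ-inject₁ j = G-edges i j
    go (‵inj₁ {i = i} _) ‵fromℕ            rewrite Fin.toℕ-inject₁ i | Fin.toℕ-fromℕ n = leaf i
    go ‵fromℕ            (‵inj₁ {i = j} _) rewrite Fin.toℕ-inject₁ j | Fin.toℕ-fromℕ n =
      mk⇔ (swap ∘ Equivalence.to (leaf j)) (Equivalence.from (leaf j) ∘ swap)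
    go ‵fromℕ            ‵fromℕ            = mk⇔ (λ ()) λ where
      (inj₁ c) → <-irrefl refl (child-< c)
      (inj₂ c) → <-irrefl refl (child-< c)

  dendrimer⁺-realises : ∀ m → Realises (dendrimer⁺ d m)
  dendrimer⁺-realises zero    Fin.zero Fin.zero = mk⇔ (λ ()) λ where
    (inj₁ ())
    (inj₂ ())
  dendrimer⁺-realises (suc m) =
    attach-realises (dendrimer⁺ d m) _ (dendrimer⁺-realises m) (toℕ-attachmentPoint m (dendrimer⁺-realises m))

  coeff-W : ∀ i m → [q^ i ] W d (suc m) ≡ ∑ (suc m) (λ v → ∑ v (λ u → δ (distance u v) i))
  coeff-W i m = coeff-wiener (dendrimer⁺ d m) (dendrimer⁺-connected d m) distance
    (dist≡distance (dendrimer⁺ d m) (dendrimer⁺-realises m) (dendrimer⁺-connected d m)) i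

-- Distances from a vertex of a given level

module Levels (d : ℕ) .{{_ : NonTrivial d}} where

  open Tree d

  private instance
    d-nonZero : NonZero d
    d-nonZero = nonTrivial⇒nonZero d

  -- σ k is the first vertex of level k + 1 (the root has level 0), and ν k is
  -- the number of vertices of that level.
  σ : ℕ → ℕ
  σ zero    = 1
  σ (suc k) = 2 + σ k * d

  ν : ℕ → ℕ
  ν zero    = suc d
  ν (suc k) = ν k * d

  σ-suc : ∀ k → σ (suc k) ≡ σ k + ν k
  σ-suc zero    = cong (2 +_) (*-identityˡ d)
  σ-suc (suc k) = cong (2 +_) (trans (cong (_* d) (σ-suc k)) (*-distribʳ-+ d (σ k) (ν k)))

  ν≡ : ∀ k → ν k ≡ suc d * d ^ k
  ν≡ zero    = sym (*-identityʳ (suc d))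
  ν≡ (suc k) = trans (cong (_* d) (ν≡ k)) (trans (*-assoc (suc d) (d ^ k) d) (cong (suc d *_) (*-comm (d ^ k) d)))

  /d<ν : ∀ k {x} → x < ν (suc k) → x / d < ν k
  /d<ν k {x} x<ν = m<n*o⇒m/o<n {x} {ν k} {d} x<ν

  par-level-zero : ∀ {x} → x < ν 0 → par (σ 0 + x) ≡ 0
  par-level-zero {zero}  _         = 0/n≡0 d
  par-level-zero {suc x} (s≤s x<d) = m<n⇒m/n≡0 x<d

  par-level-suc : ∀ k x → par (σ (suc k) + x) ≡ σ k + x / d
  par-level-suc k x = trans (+-distrib-/-∣ˡ {σ k * d} x {d} (divides-refl (σ k))) (cong (_+ x / d) (m*n/n≡m (σ k) d))

  below-level : ∀ k {x} y → x < ν k → σ k + x < σ (suc k) + y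
  below-level k {x} y x<ν = begin-strict
    σ k + x          <⟨ +-monoʳ-< (σ k) x<ν ⟩
    σ k + ν k        ≡⟨ σ-suc k ⟨
    σ (suc k)        ≤⟨ m≤m+n (σ (suc k)) y ⟩
    σ (suc k) + y    ∎
    where open ≤-Reasoning

  levelDistance : ℕ → ℕ → ℕ → ℕ
  levelDistance k y x = distance (σ k + y) (σ k + x)

  parentDistance : ℕ → ℕ → ℕ → ℕ
  parentDistance zero    y x = 0
  parentDistance (suc k) y x = levelDistance k (y / d) (x / d)

  levelDistance-refl : ∀ k x → levelDistance k x x ≡ 0
  levelDistance-refl k x = distance-refl (σ k + x)

  parentDistance-refl : ∀ k x → parentDistance k x x ≡ 0
  parentDistance-refl zero    x = refl
  parentDistance-refl (suc k) x = levelDistance-refl k (x / d)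

  -- The larger vertex moves to its parent first. That parent lies on a smaller level, so its number
  -- is below that of the other vertex, which moves next.
  levelDistance-≢ : ∀ k {y x} → y < ν k → x < ν k → y ≢ x → levelDistance k y x ≡ 2 + parentDistance k y x
  levelDistance-≢ k {y} {x} y<ν x<ν y≢x with <-cmp y x
  levelDistance-≢ k       y<ν x<ν y≢x | tri≈ _ y≡x _ = contradiction y≡x y≢x
  levelDistance-≢ zero    {y} {x} y<ν x<ν y≢x | tri< y<x _ _
    rewrite distance-< (+-monoʳ-< 1 y<x) | par-level-zero x<ν
          | distance-> (s≤s (z≤n {y})) | par-level-zero y<ν | distance-refl 0 = refl
  levelDistance-≢ zero    {y} {x} y<ν x<ν y≢x | tri> _ _ x<y
    rewrite distance-> (+-monoʳ-< 1 x<y) | par-level-zero y<ν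
          | distance-< (s≤s (z≤n {x})) | par-level-zero x<ν | distance-refl 0 = refl
  levelDistance-≢ (suc k) {y} {x} y<ν x<ν y≢x | tri< y<x _ _
    rewrite distance-< (+-monoʳ-< (σ (suc k)) y<x) | par-level-suc k x
          | distance-> (below-level k y (/d<ν k x<ν)) | par-level-suc k y = refl
  levelDistance-≢ (suc k) {y} {x} y<ν x<ν y≢x | tri> _ _ x<y
    rewrite distance-> (+-monoʳ-< (σ (suc k)) x<y) | par-level-suc k y
          | distance-< (below-level k x (/d<ν k y<ν)) | par-level-suc k x = refl

  -- sphere k i is the number of vertices of level k + 1 at distance i from a
  -- given vertex of that level; the subtracted term is the vertex itself.
  sphere : ℕ → ℕ → ℕ
  sphere k       0             = 1
  sphere k       1             = 0
  sphere zero    (suc (suc i)) = d * δ 0 i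
  sphere (suc k) (suc (suc i)) = d * sphere k i ∸ δ 0 i

  -- inner k i counts the vertices of the levels below k + 1 instead.
  inner : ℕ → ℕ → ℕ
  inner k       zero    = 0
  inner zero    (suc i) = δ 0 i
  inner (suc k) (suc i) = inner k i + sphere k i

  -- Beyond level 1, each vertex at distance `i` from the parent of `x` has `d` children at distance
  -- `i + 2` from `x`; on level 1 all `suc d` vertices share the root as parent. Only `x` itself is
  -- at distance 0 instead of 2, which accounts for `δ 0 i`.
  ∑-sphere : ∀ k i {x} → x < ν k → ∑ (ν k) (λ y → δ (levelDistance k y x) i) ≡ sphere k i
  ∑-sphere k 0 {x} x<ν = begin
    ∑ (ν k) (λ y → δ (levelDistance k y x) 0)      ≡⟨ +-identityʳ _ ⟨
    ∑ (ν k) (λ y → δ (levelDistance k y x) 0) + 0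
      ≡⟨ ∑-replace (ν k) {g = λ _ → 0} x<ν (λ y y<ν y≢x → cong (λ l → δ l 0) (levelDistance-≢ k y<ν x<ν y≢x)) ⟩
    ∑ (ν k) (λ _ → 0) + δ (levelDistance k x x) 0
      ≡⟨ cong₂ (λ a l → a + δ l 0) (∑-zero (ν k) λ _ _ → refl) (levelDistance-refl k x) ⟩
    1 ∎
    where open ≡-Reasoning
  ∑-sphere k 1 {x} x<ν = ∑-zero (ν k) go
    where
    go : ∀ y → y < ν k → δ (levelDistance k y x) 1 ≡ 0
    go y y<ν with y ≟ x
    ... | yes refl rewrite levelDistance-refl k x = refl
    ... | no y≢x   rewrite levelDistance-≢ k y<ν x<ν y≢x = refl
  ∑-sphere k (suc (suc i)) {x} x<ν = +-cancelʳ-≡ (δ 0 i) _ _ (begin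
    ∑ (ν k) (λ y → δ (levelDistance k y x) (2 + i)) + δ 0 i
      ≡⟨ cong (λ l → ∑ (ν k) (λ y → δ (levelDistance k y x) (2 + i)) + δ l i) (parentDistance-refl k x) ⟨
    ∑ (ν k) (λ y → δ (levelDistance k y x) (2 + i)) + δ (parentDistance k x x) i
      ≡⟨ ∑-replace (ν k) x<ν (λ y y<ν y≢x → cong (λ l → δ l (2 + i)) (levelDistance-≢ k y<ν x<ν y≢x)) ⟩
    ∑ (ν k) (λ y → δ (parentDistance k y x) i) + δ (levelDistance k x x) (2 + i)
      ≡⟨ cong (λ l → ∑ (ν k) (λ y → δ (parentDistance k y x) i) + δ l (2 + i)) (levelDistance-refl k x) ⟩
    ∑ (ν k) (λ y → δ (parentDistance k y x) i) + 0
      ≡⟨ +-identityʳ _ ⟩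
    ∑ (ν k) (λ y → δ (parentDistance k y x) i)
      ≡⟨ parents k x<ν ⟩
    sphere k (2 + i) + δ 0 i ∎)
    where
    open ≡-Reasoning
    -- This makes the truncated subtraction in `sphere` exact.
    sphere-pos : ∀ k i → δ 0 i ≤ d * sphere k i
    sphere-pos k zero    = ≤-trans (>-nonZero⁻¹ d) (≤-reflexive (sym (*-identityʳ d)))
    sphere-pos k (suc i) = z≤n

    parents : ∀ k {x} → x < ν k → ∑ (ν k) (λ y → δ (parentDistance k y x) i) ≡ sphere k (2 + i) + δ 0 i
    parents zero    x<ν = trans (∑-const (suc d) (δ 0 i)) (+-comm (δ 0 i) _)
    parents (suc k) {x} x<ν = begin
      ∑ (ν k * d) (λ y → δ (levelDistance k (y / d) (x / d)) i)
        ≡⟨ ∑-blocks d (ν k) (λ y → δ (levelDistance k y (x / d)) i) ⟩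
      d * ∑ (ν k) (λ y → δ (levelDistance k y (x / d)) i)
        ≡⟨ cong (d *_) (∑-sphere k i (/d<ν k x<ν)) ⟩
      d * sphere k i
        ≡⟨ m∸n+n≡m (sphere-pos k i) ⟨
      d * sphere k i ∸ δ 0 i + δ 0 i ∎

  -- A path to a smaller level starts with the step to the parent. Seen from there, the target lies
  -- either on a still smaller level or on the parent's own, whence the two summands.
  ∑-inner : ∀ k i {x} → x < ν k → ∑ (σ k) (λ u → δ (distance u (σ k + x)) i) ≡ inner k i
  ∑-inner k zero {x} x<ν =
    ∑-zero (σ k) λ u u<σ → cong (λ l → δ l 0) (distance-< (<-≤-trans u<σ (m≤m+n (σ k) x)))
  ∑-inner zero (suc i) {x} x<ν
    rewrite distance-< (s≤s (z≤n {x})) | par-level-zero x<ν | distance-refl 0 = refl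
  ∑-inner (suc k) (suc i) {x} x<ν = begin
    ∑ (σ (suc k)) (λ u → δ (distance u (σ (suc k) + x)) (suc i))
      ≡⟨ ∑-cong (σ (suc k)) (λ u u<σ → cong (λ l → δ l (suc i))
           (trans (distance-< (<-≤-trans u<σ (m≤m+n _ x))) (cong (suc ∘ distance u) (par-level-suc k x)))) ⟩
    ∑ (σ (suc k)) (λ u → δ (distance u (σ k + x / d)) i)
      ≡⟨ cong (λ n → ∑ n (λ u → δ (distance u (σ k + x / d)) i)) (σ-suc k) ⟩
    ∑ (σ k + ν k) (λ u → δ (distance u (σ k + x / d)) i)
      ≡⟨ ∑-+ (σ k) (ν k) _ ⟩
    ∑ (σ k) (λ u → δ (distance u (σ k + x / d)) i) + ∑ (ν k) (λ y → δ (levelDistance k y (x / d)) i)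
      ≡⟨ cong₂ _+_ (∑-inner k i x/d<ν) (∑-sphere k i x/d<ν) ⟩
    inner k i + sphere k i ∎
    where
    open ≡-Reasoning
    x/d<ν = /d<ν k x<ν

  -- Earlier vertices of the same level

  preceding : ℕ → ℕ → ℕ → ℕ
  preceding k i x = ∑ x (λ y → δ (levelDistance k y x) i)

  preceding≤sphere : ∀ k i {x} → x < ν k → preceding k i x ≤ sphere k i
  preceding≤sphere k i {x} x<ν = begin
    preceding k i x                                 ≤⟨ m≤m+n _ _ ⟩
    preceding k i x + ∑ (ν k ∸ x) _                 ≡⟨ ∑-+ x (ν k ∸ x) f ⟨
    ∑ (x + (ν k ∸ x)) f                             ≡⟨ cong (λ n → ∑ n f) (m+[n∸m]≡n (<⇒≤ x<ν)) ⟩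
    ∑ (ν k) f                                       ≡⟨ ∑-sphere k i x<ν ⟩
    sphere k i                                      ∎
    where
    open ≤-Reasoning
    f : ℕ → ℕ
    f y = δ (levelDistance k y x) i

  preceding-0 : ∀ k {x} → x < ν k → preceding k 0 x ≡ 0
  preceding-0 k {x} x<ν = ∑-zero x λ y y<x →
    cong (λ l → δ l 0) (levelDistance-≢ k (<-trans y<x x<ν) x<ν (<⇒≢ y<x))

  preceding-2+ : ∀ k i {x} → x < ν k → preceding k (2 + i) x ≡ ∑ x (λ y → δ (parentDistance k y x) i)
  preceding-2+ k i {x} x<ν = ∑-cong x λ y y<x →
    cong (λ l → δ l (2 + i)) (levelDistance-≢ k (<-trans y<x x<ν) x<ν (<⇒≢ y<x))

  -- Before `x` lie the complete families of `x / d` parents and `x % d` siblings of `x`; the latter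
  -- have parent distance 0.
  preceding-suc : ∀ k i {x} → x < ν (suc k) →
                  preceding (suc k) (2 + i) x ≡ d * preceding k i (x / d) + x % d * δ 0 i
  preceding-suc k i {x} x<ν = begin
    preceding (suc k) (2 + i) x                             ≡⟨ preceding-2+ (suc k) i x<ν ⟩
    ∑ x (λ y → f (y / d))                                   ≡⟨ ∑-/ d x f ⟩
    d * ∑ (x / d) f + x % d * f (x / d)
      ≡⟨ cong (λ l → d * ∑ (x / d) f + x % d * δ l i) (levelDistance-refl k (x / d)) ⟩
    d * ∑ (x / d) f + x % d * δ 0 i                         ∎
    where
    open ≡-Reasoning
    f : ℕ → ℕ
    f y = δ (levelDistance k y (x / d)) i

  /d/d^ : ∀ k x → let instance _ = m^n≢0 d k; _ = m^n≢0 d (suc k) in x / d / d ^ k ≡ x / d ^ suc k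
  /d/d^ k x = m/n/o≡m/[n*o] x d (d ^ k) {{_}} {{m^n≢0 d k}} {{m^n≢0 d (suc k)}}

  -- At this distance the path passes through the root. Each branch of the root has `d ^ k` vertices
  -- on level `k + 1`, so `x / d ^ k` is the number of the branch of `x`.
  preceding-across : ∀ k {x} → x < ν k → let instance _ = m^n≢0 d k in
                     preceding k (2 + k * 2) x ≡ d ^ k * (x / d ^ k)
  preceding-across zero    {x} x<ν = begin
    preceding 0 2 x      ≡⟨ preceding-2+ 0 0 x<ν ⟩
    ∑ x (λ _ → 1)        ≡⟨ trans (∑-const x 1) (*-comm x 1) ⟩
    1 * x                ≡⟨ cong (1 *_) (n/1≡n x) ⟨
    1 * (x / 1)          ∎
    where open ≡-Reasoning
  preceding-across (suc k) {x} x<ν = begin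
    preceding (suc k) (4 + k * 2) x                              ≡⟨ preceding-suc k (2 + k * 2) x<ν ⟩
    d * preceding k (2 + k * 2) (x / d) + x % d * 0
      ≡⟨ cong₂ (λ a b → d * a + b) (preceding-across k (/d<ν k x<ν)) (*-zeroʳ (x % d)) ⟩
    d * (d ^ k * (x / d / d ^ k)) + 0                            ≡⟨ +-identityʳ _ ⟩
    d * (d ^ k * (x / d / d ^ k))                                ≡⟨ *-assoc d (d ^ k) _ ⟨
    d ^ suc k * (x / d / d ^ k)                                  ≡⟨ cong (d ^ suc k *_) (/d/d^ k x) ⟩
    d ^ suc k * (x / d ^ suc k)                                  ∎
    where
    open ≡-Reasoning
    instance
      _ = m^n≢0 d k
      _ = m^n≢0 d (suc k)

  -- On level `k + 2` a path of this length turns at level 1: it joins two subbranches of one branch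
  -- of the root. The subbranch of `x` has number `x / d ^ k % d` within its branch.
  preceding-within : ∀ k {x} → x < ν (suc k) → let instance _ = m^n≢0 d k in
                     preceding (suc k) (2 + k * 2) x ≡ d ^ k * (x / d ^ k % d)
  preceding-within zero {x} x<ν = begin
    preceding 1 2 x                                 ≡⟨ preceding-suc 0 0 x<ν ⟩
    d * preceding 0 0 (x / d) + x % d * 1
      ≡⟨ cong₂ (λ a b → d * a + b) (preceding-0 0 (/d<ν 0 x<ν)) (*-identityʳ (x % d)) ⟩
    d * 0 + x % d                                   ≡⟨ cong (_+ x % d) (*-zeroʳ d) ⟩
    x % d                                           ≡⟨ cong (_% d) (n/1≡n x) ⟨
    x / 1 % d                                       ≡⟨ *-identityˡ _ ⟨
    1 * (x / 1 % d)                                 ∎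
    where open ≡-Reasoning
  preceding-within (suc k) {x} x<ν = begin
    preceding (2 + k) (4 + k * 2) x                              ≡⟨ preceding-suc (suc k) (2 + k * 2) x<ν ⟩
    d * preceding (suc k) (2 + k * 2) (x / d) + x % d * 0
      ≡⟨ cong₂ (λ a b → d * a + b) (preceding-within k (/d<ν (suc k) x<ν)) (*-zeroʳ (x % d)) ⟩
    d * (d ^ k * (x / d / d ^ k % d)) + 0                        ≡⟨ +-identityʳ _ ⟩
    d * (d ^ k * (x / d / d ^ k % d))                            ≡⟨ *-assoc d (d ^ k) _ ⟨
    d ^ suc k * (x / d / d ^ k % d)
      ≡⟨ cong (λ z → d ^ suc k * (z % d)) (/d/d^ k x) ⟩
    d ^ suc k * (x / d ^ suc k % d)                              ∎
    where
    open ≡-Reasoning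
    instance
      _ = m^n≢0 d k
      _ = m^n≢0 d (suc k)

  -- Values and stability of the level counts

  sphere-stable : ∀ k {i} → i ≤ 1 + k * 2 → sphere (suc k) i ≡ sphere k i
  sphere-stable k       {0}           _ = refl
  sphere-stable k       {1}           _ = refl
  sphere-stable zero    {suc (suc i)} (s≤s ())
  sphere-stable (suc k) {suc (suc i)} (s≤s (s≤s i≤)) = cong (λ s → d * s ∸ δ 0 i) (sphere-stable k i≤)

  sphere-odd : ∀ k → sphere k (1 + k * 2) ≡ 0
  sphere-odd zero    = refl
  sphere-odd (suc k) = trans (cong (d *_) (sphere-odd k)) (*-zeroʳ d)

  sphere-top : ∀ k → sphere k (2 + k * 2) ≡ d ^ suc k
  sphere-top zero    = refl
  sphere-top (suc k) = cong (d *_) (sphere-top k)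

  -- The value is `d - 1` times `d ^ k`: the path turns at a level 1 vertex with `d - 1` other
  -- children, whereas in `sphere-top` the root has `d` other branches.
  sphere-below-top : ∀ k → d ^ k + sphere (suc k) (2 + k * 2) ≡ d ^ suc k
  sphere-below-top zero    = m+[n∸m]≡n (≤-trans (>-nonZero⁻¹ d) (≤-reflexive (sym (*-identityʳ d))))
  sphere-below-top (suc k) = trans (sym (*-distribˡ-+ d (d ^ k) _)) (cong (d *_) (sphere-below-top k))

  sphere-vanish : ∀ k {i} → 3 + k * 2 ≤ i → sphere k i ≡ 0
  sphere-vanish zero    {suc (suc (suc i))} _              = *-zeroʳ d
  sphere-vanish zero    {suc (suc zero)}    (s≤s (s≤s ()))
  sphere-vanish zero    {suc zero}          (s≤s ())
  sphere-vanish (suc k) {suc (suc i)}       (s≤s (s≤s i≥)) =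
    trans (cong (λ s → d * s ∸ δ 0 i) (sphere-vanish k i≥)) (trans (cong (_∸ δ 0 i) (*-zeroʳ d)) (0∸n≡0 (δ 0 i)))

  inner-vanish : ∀ k {i} → 2 + k * 2 ≤ i → inner k i ≡ 0
  inner-vanish zero    {suc (suc i)} _        = refl
  inner-vanish zero    {suc zero}    (s≤s ())
  inner-vanish (suc k) {suc i}       (s≤s i≥) = cong₂ _+_ (inner-vanish k (≤-trans (n≤1+n _) i≥)) (sphere-vanish k i≥)

  inner-top : ∀ k → inner k (1 + k * 2) ≡ d ^ k
  inner-top zero    = refl
  inner-top (suc k) = cong₂ _+_ (inner-vanish k ≤-refl) (sphere-top k)

  inner-below-top : ∀ k → inner (suc k) (2 + k * 2) ≡ d ^ k
  inner-below-top k = trans (cong₂ _+_ (inner-top k) (sphere-odd k)) (+-identityʳ _)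

  inner-stable : ∀ k {i} → i ≤ k * 2 → inner (suc k) (suc i) ≡ inner k (suc i)
  inner-stable zero    {zero}  _ = refl
  inner-stable (suc k) {zero}  _ = refl
  inner-stable (suc k) {suc i} (s≤s i≤) with m≤n⇒m<n∨m≡n i≤
  ... | inj₁ i< = cong₂ _+_ (inner-stable k (s≤s⁻¹ i<)) (sphere-stable k i<)
  -- At the largest index the spheres of the two levels differ, but what `sphere` loses, `d ^ k`, is
  -- what `inner` gains.
  ... | inj₂ refl = begin
    inner (suc k) (2 + k * 2) + sphere (suc k) (2 + k * 2)
      ≡⟨ cong (_+ sphere (suc k) (2 + k * 2)) (inner-below-top k) ⟩
    d ^ k + sphere (suc k) (2 + k * 2)                       ≡⟨ sphere-below-top k ⟩
    d ^ suc k                                                ≡⟨ inner-top (suc k) ⟨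
    inner (suc k) (3 + k * 2)                                ∎
    where open ≡-Reasoning

  -- For `x < ν k` this is `c_i(v)` with `v = σ k + x`.
  earlier : ℕ → ℕ → ℕ → ℕ
  earlier k i x = inner k i + preceding k i x

  -- Admitting the whole level of `x` gives the count for distance `i + 1` seen from a child of that
  -- vertex, and by stability this equals the inner count one level up.
  earlier-mono : ∀ k {i x} → x < ν k → i ≤ k * 2 → earlier k i x ≤ earlier k (suc i) x
  earlier-mono k {i} {x} x<ν i≤ = begin
    inner k i + preceding k i x              ≤⟨ +-monoʳ-≤ (inner k i) (preceding≤sphere k i x<ν) ⟩
    inner (suc k) (suc i)                    ≡⟨ inner-stable k i≤ ⟩
    inner k (suc i)                          ≤⟨ m≤m+n _ _ ⟩
    earlier k (suc i) x                      ∎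
    where open ≤-Reasoning

  earlier-odd : ∀ k {x} → x < ν k → earlier k (1 + k * 2) x ≡ d ^ k
  earlier-odd k {x} x<ν = trans
    (cong₂ _+_ (inner-top k) (n≤0⇒n≡0 (≤-trans (preceding≤sphere k (1 + k * 2) x<ν) (≤-reflexive (sphere-odd k)))))
    (+-identityʳ _)

  earlier-vanish : ∀ k {i x} → x < ν k → 3 + k * 2 ≤ i → earlier k i x ≡ 0
  earlier-vanish k {i} {x} x<ν i≥ = cong₂ _+_ (inner-vanish k (≤-trans (n≤1+n _) i≥))
    (n≤0⇒n≡0 (≤-trans (preceding≤sphere k i x<ν) (≤-reflexive (sphere-vanish k i≥))))

  coeff : ℕ → ℕ → ℕ
  coeff i n = ∑ n (λ v → ∑ v (λ u → δ (distance u v) i))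

  coeff-level : ∀ k i {x} → x ≤ ν k → coeff i (σ k + x) ≡ coeff i (σ k) + ∑ x (earlier k i)
  coeff-level k i {x} x≤ν = begin
    coeff i (σ k + x)
      ≡⟨ ∑-+ (σ k) x _ ⟩
    coeff i (σ k) + ∑ x (λ y → ∑ (σ k + y) (λ u → δ (distance u (σ k + y)) i))
      ≡⟨ cong (coeff i (σ k) +_) (∑-cong x λ y y<x → trans (∑-+ (σ k) y _)
           (cong (_+ preceding k i y) (∑-inner k i (<-≤-trans y<x x≤ν)))) ⟩
    coeff i (σ k) + ∑ x (earlier k i) ∎
    where open ≡-Reasoning

-- Growth of the coefficients along a level

module Coefficients (d : ℕ) .{{_ : NonTrivial d}} where

  open Tree d
  open Levels d

  private instance
    d-nonZero : NonZero d
    d-nonZero = nonTrivial⇒nonZero d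

  -- The first `σ (suc k)` vertices are those with level `k + 1` complete, so the full case at
  -- `suc k` is the partial case at `k`.
  coeff-vanish-full : ∀ k {i} → k * 2 < i → coeff i (σ k) ≡ 0
  coeff-vanish : ∀ k {i x} → x ≤ ν k → 2 + k * 2 < i → coeff i (σ k + x) ≡ 0

  coeff-vanish-full zero    _  = refl
  coeff-vanish-full (suc k) i> = trans (cong (coeff _) (σ-suc k)) (coeff-vanish k ≤-refl i>)

  coeff-vanish k {i} {x} x≤ν i> = trans (coeff-level k i x≤ν) (cong₂ _+_
    (coeff-vanish-full k (≤-trans (s≤s (m≤n+m (k * 2) 2)) i>))
    (∑-zero x λ y y<x → earlier-vanish k (<-≤-trans y<x x≤ν) i>))

  coeff-0 : ∀ n → coeff 0 n ≡ 0
  coeff-0 n = ∑-zero n λ v _ → ∑-zero v λ u u<v → cong (λ l → δ l 0) (distance-< u<v)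

  -- Pairs among the first `σ k` vertices have distance at most `k * 2`; only the `x` further
  -- vertices count, each with `d ^ k`.
  coeff-odd : ∀ k {x} → x ≤ ν k → coeff (1 + k * 2) (σ k + x) ≡ x * d ^ k
  coeff-odd k {x} x≤ν = begin
    coeff (1 + k * 2) (σ k + x)                              ≡⟨ coeff-level k (1 + k * 2) x≤ν ⟩
    coeff (1 + k * 2) (σ k) + ∑ x (earlier k (1 + k * 2))
      ≡⟨ cong₂ _+_ (coeff-vanish-full k ≤-refl) (∑-cong x λ y y<x → earlier-odd k (<-≤-trans y<x x≤ν)) ⟩
    ∑ x (λ _ → d ^ k)                                        ≡⟨ ∑-const x (d ^ k) ⟩
    x * d ^ k                                                ∎
    where open ≡-Reasoning

  coeff-even : ∀ k {x} → x ≤ ν k → let instance _ = m^n≢0 d k in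
               coeff (2 + k * 2) (σ k + x) ≡ d ^ k * ∑ x (_/ d ^ k)
  coeff-even k {x} x≤ν = begin
    coeff (2 + k * 2) (σ k + x)                              ≡⟨ coeff-level k (2 + k * 2) x≤ν ⟩
    coeff (2 + k * 2) (σ k) + ∑ x (earlier k (2 + k * 2))
      ≡⟨ cong₂ _+_ (coeff-vanish-full k (n≤1+n _)) (∑-cong x λ y y<x →
           cong₂ _+_ (inner-vanish k ≤-refl) (preceding-across k (<-≤-trans y<x x≤ν))) ⟩
    ∑ x (λ y → d ^ k * (y / d ^ k))                          ≡⟨ *-distribˡ-∑ (d ^ k) x _ ⟩
    d ^ k * ∑ x (_/ d ^ k)                                   ∎
    where
    open ≡-Reasoning
    instance _ = m^n≢0 d k

  -- With `d ^ k` taken out, this compares `∑ x (_/ d ^ k)` with `x`; the balance tips at three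
  -- blocks, that is, three branches.
  coeff-even-≤-odd : ∀ k {x} → x ≤ ν k → x ≤ 3 * d ^ k →
    coeff (2 + k * 2) (σ k + x) ≤ coeff (1 + k * 2) (σ k + x)
  coeff-even-≤-odd k {x} x≤ν x≤3d^k = begin
    coeff (2 + k * 2) (σ k + x)    ≡⟨ coeff-even k x≤ν ⟩
    d ^ k * ∑ x (_/ d ^ k)         ≤⟨ *-monoʳ-≤ (d ^ k) (∑-/-≤ (d ^ k) x≤3d^k) ⟩
    d ^ k * x                      ≡⟨ *-comm (d ^ k) x ⟩
    x * d ^ k                      ≡⟨ coeff-odd k x≤ν ⟨
    coeff (1 + k * 2) (σ k + x)    ∎
    where
    open ≤-Reasoning
    instance _ = m^n≢0 d k

  coeff-odd-≤-even : ∀ k {x} → x ≤ ν k → 3 * d ^ k ≤ x →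
    coeff (1 + k * 2) (σ k + x) ≤ coeff (2 + k * 2) (σ k + x)
  coeff-odd-≤-even k {x} x≤ν 3d^k≤x = begin
    coeff (1 + k * 2) (σ k + x)    ≡⟨ coeff-odd k x≤ν ⟩
    x * d ^ k                      ≡⟨ *-comm x (d ^ k) ⟩
    d ^ k * x                      ≤⟨ *-monoʳ-≤ (d ^ k) (∑-/-≥ (d ^ k) 3d^k≤x) ⟩
    d ^ k * ∑ x (_/ d ^ k)         ≡⟨ coeff-even k x≤ν ⟨
    coeff (2 + k * 2) (σ k + x)    ∎
    where
    open ≤-Reasoning
    instance _ = m^n≢0 d k

  coeff-top-full : ∀ k → coeff (2 + k * 2) (σ (suc k)) ≡ d ^ k * (d ^ k * triangular d)
  coeff-top-full k = begin
    coeff (2 + k * 2) (σ (suc k))                      ≡⟨ cong (coeff (2 + k * 2)) (σ-suc k) ⟩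
    coeff (2 + k * 2) (σ k + ν k)                      ≡⟨ coeff-even k ≤-refl ⟩
    d ^ k * ∑ (ν k) (_/ d ^ k)                         ≡⟨ cong (λ n → d ^ k * ∑ n (_/ d ^ k)) (ν≡ k) ⟩
    d ^ k * ∑ (suc d * d ^ k) (_/ d ^ k)
      ≡⟨ cong (d ^ k *_) (∑-blocks (d ^ k) (suc d) (λ w → w)) ⟩
    d ^ k * (d ^ k * ∑ (suc d) (λ w → w))              ≡⟨ cong (λ t → d ^ k * (d ^ k * t)) (∑-id d) ⟩
    d ^ k * (d ^ k * triangular d)                     ∎
    where
    open ≡-Reasoning
    instance _ = m^n≢0 d k

  -- A vertex of subbranch `w` receives `d ^ k` from smaller levels and `d ^ k` from each earlier
  -- subbranch of its branch, hence `suc (w % d)`. Three branches have `3 * d` subbranches.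
  ∑-earlier-within : ∀ k → 3 * d ^ suc k ≤ ν (suc k) →
                     ∑ (3 * d ^ suc k) (earlier (suc k) (2 + k * 2)) ≡ d ^ k * (d ^ k * (3 * triangular d))
  ∑-earlier-within k 3d^≤ν = begin
    ∑ (3 * d ^ suc k) (earlier (suc k) (2 + k * 2))
      ≡⟨ ∑-cong (3 * d ^ suc k) (λ y y< → trans
           (cong₂ _+_ (inner-below-top k) (preceding-within k (<-≤-trans y< 3d^≤ν)))
           (sym (*-suc (d ^ k) _))) ⟩
    ∑ (3 * d ^ suc k) (λ y → d ^ k * f (y / d ^ k))
      ≡⟨ *-distribˡ-∑ (d ^ k) (3 * d ^ suc k) _ ⟩
    d ^ k * ∑ (3 * d ^ suc k) (λ y → f (y / d ^ k))
      ≡⟨ cong (λ n → d ^ k * ∑ n (λ y → f (y / d ^ k))) (*-assoc 3 d (d ^ k)) ⟨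
    d ^ k * ∑ (3 * d * d ^ k) (λ y → f (y / d ^ k))
      ≡⟨ cong (d ^ k *_) (∑-blocks (d ^ k) (3 * d) f) ⟩
    d ^ k * (d ^ k * ∑ (3 * d) f)
      ≡⟨ cong (λ t → d ^ k * (d ^ k * t)) (∑-% d 3 suc) ⟩
    d ^ k * (d ^ k * (3 * triangular d)) ∎
    where
    open ≡-Reasoning
    instance _ = m^n≢0 d k
    f : ℕ → ℕ
    f w = suc (w % d)

  3*d^≤ν : ∀ k → 3 * d ^ k ≤ ν k
  3*d^≤ν k = ≤-trans (*-monoˡ-≤ (d ^ k) (s≤s (nonTrivial⇒n>1 d))) (≤-reflexive (sym (ν≡ k)))

  -- Here d ≥ 2 enters through 2 (d + 1) ≤ 3 d.
  coeff-below-top-≤-top : ∀ k {x} → x ≤ ν k → 3 * d ^ k ≤ x →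
    coeff (k * 2) (σ k + x) ≤ coeff (1 + k * 2) (σ k + x)
  coeff-below-top-≤-top zero    {x} _   _      = ≤-trans (≤-reflexive (coeff-0 (σ 0 + x))) z≤n
  coeff-below-top-≤-top (suc k) {x} x≤ν 3d^≤x with x ∸ 3 * d ^ suc k | m+[n∸m]≡n 3d^≤x
  ... | z | refl = begin
    coeff (2 + k * 2) (σ (suc k) + (b + z))
      ≡⟨ coeff-level (suc k) (2 + k * 2) x≤ν ⟩
    coeff (2 + k * 2) (σ (suc k)) + ∑ (b + z) (earlier (suc k) (2 + k * 2))
      ≡⟨ cong₂ _+_ (coeff-top-full k) (∑-+ b z _) ⟩
    e * (e * t) + (∑ b (earlier (suc k) (2 + k * 2)) + ∑ z (λ y → earlier (suc k) (2 + k * 2) (b + y)))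
      ≡⟨ cong (λ s → e * (e * t) + (s + ∑ z (λ y → earlier (suc k) (2 + k * 2) (b + y)))) (∑-earlier-within k (3*d^≤ν (suc k))) ⟩
    e * (e * t) + (e * (e * (3 * t)) + ∑ z (λ y → earlier (suc k) (2 + k * 2) (b + y)))
      ≡⟨ +-assoc (e * (e * t)) _ _ ⟨
    e * (e * t) + e * (e * (3 * t)) + ∑ z (λ y → earlier (suc k) (2 + k * 2) (b + y))
      -- `bound` settles the first three branches. Each of the `z` further vertices adds at most
      -- `d ^ suc k` on the left and exactly that much on the right.
      ≤⟨ +-mono-≤ bound (∑-mono-≤ z λ y y<z →
           let b+y<ν = <-≤-trans (+-monoʳ-< b y<z) x≤ν in
           ≤-trans (earlier-mono (suc k) b+y<ν ≤-refl) (≤-reflexive (earlier-odd (suc k) b+y<ν))) ⟩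
    b * d ^ suc k + ∑ z (λ _ → d ^ suc k)
      ≡⟨ cong (b * d ^ suc k +_) (∑-const z (d ^ suc k)) ⟩
    b * d ^ suc k + z * d ^ suc k
      ≡⟨ *-distribʳ-+ (d ^ suc k) b z ⟨
    (b + z) * d ^ suc k
      ≡⟨ coeff-odd (suc k) x≤ν ⟨
    coeff (3 + k * 2) (σ (suc k) + (b + z)) ∎
    where
    open ≤-Reasoning
    b = 3 * d ^ suc k
    e = d ^ k
    t = triangular d

    collect : ∀ e t → e * (e * t) + e * (e * (3 * t)) ≡ e * (e * (2 * (2 * t)))
    collect = solve-∀
    expand : ∀ e d → e * (e * (2 * (suc d * d))) ≡ e * (e * ((2 + (d + d)) * d))
    expand = solve-∀
    final : ∀ e d → e * (e * ((d + (d + d)) * d)) ≡ 3 * (d * e) * (d * e)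
    final = solve-∀

    bound : e * (e * t) + e * (e * (3 * t)) ≤ b * d ^ suc k
    bound = begin
      e * (e * t) + e * (e * (3 * t))      ≡⟨ collect e t ⟩
      e * (e * (2 * (2 * t)))              ≡⟨ cong (λ s → e * (e * (2 * s))) (2*triangular d) ⟩
      e * (e * (2 * (suc d * d)))          ≡⟨ expand e d ⟩
      e * (e * ((2 + (d + d)) * d))
        ≤⟨ *-monoʳ-≤ e (*-monoʳ-≤ e (*-monoˡ-≤ d (+-monoˡ-≤ (d + d) (nonTrivial⇒n>1 d)))) ⟩
      e * (e * ((d + (d + d)) * d))        ≡⟨ final e d ⟩
      3 * (d * e) * (d * e)                ∎

  -- One induction on `k` proves all three: a complete level is a late case because the root has at
  -- least three branches, the late case adds two comparisons to `coeff-mono`, and `coeff-mono`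
  -- builds on the complete levels before it.
  coeff-mono-full : ∀ k {i} → i < k * 2 → coeff i (σ k) ≤ coeff (suc i) (σ k)
  coeff-mono : ∀ k {i x} → x ≤ ν k → i < k * 2 → coeff i (σ k + x) ≤ coeff (suc i) (σ k + x)
  coeff-mono-late : ∀ k {i x} → x ≤ ν k → 3 * d ^ k ≤ x → i < 2 + k * 2 →
    coeff i (σ k + x) ≤ coeff (suc i) (σ k + x)

  coeff-mono-full (suc k) {i} i< =
    subst (λ n → coeff i n ≤ coeff (suc i) n) (sym (σ-suc k)) (coeff-mono-late k ≤-refl (3*d^≤ν k) i<)

  coeff-mono k {i} {x} x≤ν i< = begin
    coeff i (σ k + x)                                  ≡⟨ coeff-level k i x≤ν ⟩
    coeff i (σ k) + ∑ x (earlier k i)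
      ≤⟨ +-mono-≤ (coeff-mono-full k i<) (∑-mono-≤ x λ y y<x → earlier-mono k (<-≤-trans y<x x≤ν) (<⇒≤ i<)) ⟩
    coeff (suc i) (σ k) + ∑ x (earlier k (suc i))      ≡⟨ coeff-level k (suc i) x≤ν ⟨
    coeff (suc i) (σ k + x)                            ∎
    where open ≤-Reasoning

  coeff-mono-late k {i} x≤ν 3d^≤x (s≤s i≤1+2k) with m≤n⇒m<n∨m≡n i≤1+2k
  ... | inj₂ refl = coeff-odd-≤-even k x≤ν 3d^≤x
  ... | inj₁ (s≤s i≤2k) with m≤n⇒m<n∨m≡n i≤2k
  ...   | inj₂ refl = coeff-below-top-≤-top k x≤ν 3d^≤x
  ...   | inj₁ i<2k = coeff-mono k x≤ν i<2k

  -- A complete level is returned as `x = ν k`, and the next vertex then starts the following level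
  -- with `x = 1`.
  locate : ∀ {n} → 2 ≤ n → ∃ λ k → ∃ λ x → x ≤ ν k × n ≡ σ k + x
  locate {suc zero}          (s≤s ())
  locate {suc (suc zero)}    _ = 0 , 1 , s≤s z≤n , refl
  locate {suc (suc (suc n))} _ with locate {2 + n} (s≤s (s≤s z≤n))
  ... | k , x , x≤ν , n≡ with m≤n⇒m<n∨m≡n x≤ν
  ...   | inj₁ x<ν  = k , suc x , x<ν , trans (cong suc n≡) (sym (+-suc (σ k) x))
  ...   | inj₂ refl = suc k , 1 , 0<ν (suc k) , trans (cong suc (trans n≡ (sym (σ-suc k)))) (sym (+-comm (σ (suc k)) 1))
    where
    0<ν : ∀ k → 0 < ν k
    0<ν k = ≤-trans (≤-trans (m^n>0 d k) (m≤m+n (d ^ k) (2 * d ^ k))) (3*d^≤ν k)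

  -- Closed forms of the thresholds

  repunit : ℕ → ℕ
  repunit zero    = 0
  repunit (suc k) = suc (d * repunit k)

  d≡ : d ≡ suc (d ∸ 1)
  d≡ = sym (m+[n∸m]≡n (>-nonZero⁻¹ d))

  d^≡ : ∀ k → d ^ k ≡ suc (repunit k * (d ∸ 1))
  d^≡ zero    = refl
  d^≡ (suc k) = begin
    d * d ^ k                                      ≡⟨ cong (d *_) (d^≡ k) ⟩
    d * suc (repunit k * (d ∸ 1))                  ≡⟨ expand d (repunit k) (d ∸ 1) ⟩
    d + d * repunit k * (d ∸ 1)                    ≡⟨ cong (_+ d * repunit k * (d ∸ 1)) d≡ ⟩
    suc (repunit (suc k) * (d ∸ 1))                ∎
    where
    open ≡-Reasoning
    expand : ∀ a b c → a * suc (b * c) ≡ a + a * b * c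
    expand = solve-∀

  geometric≡ : ∀ k → geometric d k ≡ repunit k
  geometric≡ k = trans (cong (λ m → (m ∸ 1) / (d ∸ 1)) (d^≡ k)) (m*n/n≡m (repunit k) (d ∸ 1))
    where
    instance
      _ : NonZero (d ∸ 1)
      _ = >-nonZero (m<n⇒0<n∸m (nonTrivial⇒n>1 d))

  σ≡ : ∀ k → σ k ≡ 1 + (d + 1) * repunit k
  σ≡ zero    = cong suc (sym (*-zeroʳ (d + 1)))
  σ≡ (suc k) = trans (cong (λ s → 2 + s * d) (σ≡ k)) (expand d (repunit k))
    where
    expand : ∀ d g → 2 + (1 + (d + 1) * g) * d ≡ 1 + (d + 1) * suc (d * g)
    expand = solve-∀

  -- So `nₖ d k` is the size at which level `k + 1` receives its first vertex.
  nₖ≡ : ∀ k → nₖ d k ≡ suc (σ k)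
  nₖ≡ k rewrite geometric≡ k | σ≡ k = refl

  -- So `pₖ d k` is the size at which three branches are complete on level `k + 1`.
  pₖ≡ : ∀ k → pₖ d k ≡ σ k + 3 * d ^ k
  pₖ≡ k = begin
    2 + 2 * d * geometric d k + 2 * d ^ k      ≡⟨ cong (λ g → 2 + 2 * d * g + 2 * d ^ k) (geometric≡ k) ⟩
    2 + 2 * d * g + 2 * d ^ k                  ≡⟨ cong (λ c → 2 + 2 * c * g + 2 * d ^ k) d≡ ⟩
    2 + 2 * suc c * g + 2 * d ^ k              ≡⟨ expand c g (d ^ k) ⟩
    1 + (suc c + 1) * g + (suc (g * c) + 2 * d ^ k)
      ≡⟨ cong₂ (λ a b → 1 + (a + 1) * g + (b + 2 * d ^ k)) (sym d≡) (sym (d^≡ k)) ⟩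
    1 + (d + 1) * g + 3 * d ^ k                ≡⟨ cong (_+ 3 * d ^ k) (σ≡ k) ⟨
    σ k + 3 * d ^ k                            ∎
    where
    open ≡-Reasoning
    g = repunit k
    c = d ∸ 1
    expand : ∀ c g e → 2 + 2 * suc c * g + 2 * e ≡ 1 + (suc c + 1) * g + (suc (g * c) + 2 * e)
    expand = solve-∀

-- Unimodality and maxima of sequences that vanish from some index on

nondecreasing-≤ : ∀ {a m} → WeaklyIncreasingUpTo a m → ∀ {i} → i ≤ m → a i ≤ a m
nondecreasing-≤ {a} {zero}  inc z≤n = ≤-refl
nondecreasing-≤ {a} {suc m} inc {i} i≤ with m≤n⇒m<n∨m≡n i≤
... | inj₂ refl      = ≤-refl
... | inj₁ (s≤s i≤m) = ≤-trans (nondecreasing-≤ {a} (λ j j<m → inc j (m<n⇒m<1+n j<m)) i≤m) (inc m ≤-refl)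

module _ {a : ℕ → ℕ} {m : ℕ} (vanish : ∀ i → 2 + m < i → a i ≡ 0) where

  decreasing-beyond : ∀ i → 2 + m ≤ i → a (suc i) ≤ a i
  decreasing-beyond i i≥ = ≤-trans (≤-reflexive (vanish (suc i) (s≤s i≥))) z≤n

  module Late (inc : WeaklyIncreasingUpTo a (2 + m)) where

    unimodal : Unimodal a
    unimodal = 2 + m , inc , decreasing-beyond

    maximum : IsMaximumAt a (2 + m)
    maximum i with ≤-<-connex i (2 + m)
    ... | inj₁ i≤ = nondecreasing-≤ {a} inc i≤
    ... | inj₂ i> = ≤-trans (≤-reflexive (vanish i i>)) z≤n

  module Early (inc : WeaklyIncreasingUpTo a m) (drop : a (2 + m) ≤ a (1 + m)) where

    beyond : ∀ i → 1 + m ≤ i → a (suc i) ≤ a i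
    beyond i i≥ with m≤n⇒m<n∨m≡n i≥
    ... | inj₁ i>   = decreasing-beyond i i>
    ... | inj₂ refl = drop

    bounded : ∀ i → a i ≤ a m ⊎ a i ≤ a (1 + m)
    bounded i with ≤-<-connex i m
    ... | inj₁ i≤m = inj₁ (nondecreasing-≤ {a} inc i≤m)
    ... | inj₂ m<i with m≤n⇒m<n∨m≡n m<i
    ...   | inj₂ refl = inj₂ ≤-refl
    ...   | inj₁ 1+m<i with m≤n⇒m<n∨m≡n 1+m<i
    ...     | inj₂ refl  = inj₂ drop
    ...     | inj₁ 2+m<i = inj₁ (≤-trans (≤-reflexive (vanish i 2+m<i)) z≤n)

    -- Either of `a m` and `a (1 + m)` may be the larger; their comparison decides where the peak
    -- lies.
    unimodal : Unimodal a
    unimodal with ≤-total (a m) (a (1 + m))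
    ... | inj₁ rise = 1 + m , inc′ , beyond
      where
      inc′ : ∀ i → i < 1 + m → a i ≤ a (suc i)
      inc′ i (s≤s i≤m) with m≤n⇒m<n∨m≡n i≤m
      ... | inj₁ i<m  = inc i i<m
      ... | inj₂ refl = rise
    ... | inj₂ fall = m , inc , dec
      where
      dec : ∀ i → m ≤ i → a (suc i) ≤ a i
      dec i m≤i with m≤n⇒m<n∨m≡n m≤i
      ... | inj₁ m<i  = beyond i m<i
      ... | inj₂ refl = fall

    maximum : IsMaximumAt a m ⊎ IsMaximumAt a (1 + m)
    maximum with ≤-total (a m) (a (1 + m))
    ... | inj₁ rise = inj₂ λ i → [ (λ le → ≤-trans le rise) , id ]′ (bounded i)
    ... | inj₂ fall = inj₁ λ i → [ id , (λ le → ≤-trans le fall) ]′ (bounded i)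

theorem3p3 : (d n : ℕ) .{{_ : NonTrivial d}} → 2 ≤ n →
    let a = λ (i : ℕ) → [q^ i ] W d n in
    Unimodal a
    × (∀ k → nₖ d k ≤ n → n < pₖ d k → IsMaximumAt a (2 * k) ⊎ IsMaximumAt a (2 * k + 1))
    × (∀ k → pₖ d k ≤ n → n < nₖ d (k + 1) →
    IsMaximumAt a (2 * k + 2) × WeaklyIncreasingUpTo a (2 * k + 2))
theorem3p3 d n@(suc n-1) 2≤n = unimodal , early , late
  where
  open Tree d
  open Levels d
  open Coefficients d

  a : ℕ → ℕ
  a i = [q^ i ] W d n

  module At k {x} (x≤ν : x ≤ ν k) (n≡ : n ≡ σ k + x) where

    a≡ : ∀ i → a i ≡ coeff i (σ k + x)
    a≡ i = trans (coeff-W i n-1) (cong (coeff i) n≡)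

    transport : ∀ {i j} → coeff i (σ k + x) ≤ coeff j (σ k + x) → a i ≤ a j
    transport {i} {j} = subst₂ _≤_ (sym (a≡ i)) (sym (a≡ j))

    vanish : ∀ i → 2 + k * 2 < i → a i ≡ 0
    vanish i i> = trans (a≡ i) (coeff-vanish k x≤ν i>)

    module AtEarly (x≤3d^ : x ≤ 3 * d ^ k) = Early {a} vanish
      (λ i i< → transport (coeff-mono k x≤ν i<)) (transport (coeff-even-≤-odd k x≤ν x≤3d^))

    increasing : 3 * d ^ k ≤ x → WeaklyIncreasingUpTo a (2 + k * 2)
    increasing 3d^≤x i i< = transport (coeff-mono-late k x≤ν 3d^≤x i<)

    module AtLate (3d^≤x : 3 * d ^ k ≤ x) = Late {a} vanish (increasing 3d^≤x)

  unimodal : Unimodal a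
  unimodal with locate 2≤n
  ... | k , x , x≤ν , n≡ with ≤-total x (3 * d ^ k)
  ...   | inj₁ x≤3d^ = At.AtEarly.unimodal k x≤ν n≡ x≤3d^
  ...   | inj₂ 3d^≤x = At.AtLate.unimodal k x≤ν n≡ 3d^≤x

  early : ∀ k → nₖ d k ≤ n → n < pₖ d k → IsMaximumAt a (2 * k) ⊎ IsMaximumAt a (2 * k + 1)
  early k nₖ≤n n<pₖ
    rewrite +-comm (2 * k) 1 | *-comm 2 k = At.AtEarly.maximum k (≤-trans x≤3d^ (3*d^≤ν k)) n≡ x≤3d^
    where
    x = n ∸ σ k
    n≡ : n ≡ σ k + x
    n≡ = sym (m+[n∸m]≡n (<⇒≤ (subst (_≤ n) (nₖ≡ k) nₖ≤n)))
    x≤3d^ : x ≤ 3 * d ^ k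
    x≤3d^ = +-cancelˡ-≤ (σ k) x _ (subst₂ _≤_ n≡ (pₖ≡ k) (<⇒≤ n<pₖ))

  late : ∀ k → pₖ d k ≤ n → n < nₖ d (k + 1) → IsMaximumAt a (2 * k + 2) × WeaklyIncreasingUpTo a (2 * k + 2)
  late k pₖ≤n n<nₖ
    rewrite +-comm (2 * k) 2 | *-comm 2 k = At.AtLate.maximum k x≤ν n≡ 3d^≤x , At.increasing k x≤ν n≡ 3d^≤x
    where
    x = n ∸ σ k
    σ+3d^≤n : σ k + 3 * d ^ k ≤ n
    σ+3d^≤n = subst (_≤ n) (pₖ≡ k) pₖ≤n
    n≡ : n ≡ σ k + x
    n≡ = sym (m+[n∸m]≡n (≤-trans (m≤m+n (σ k) _) σ+3d^≤n))
    3d^≤x : 3 * d ^ k ≤ x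
    3d^≤x = +-cancelˡ-≤ (σ k) _ x (subst (σ k + 3 * d ^ k ≤_) n≡ σ+3d^≤n)
    -- As `nₖ d (suc k)` is `suc (σ (suc k))`, the strict bound still admits the complete level
    -- `x = ν k`.
    n≤σ : n ≤ σ (suc k)
    n≤σ = s≤s⁻¹ (subst (n <_) (trans (cong (nₖ d) (+-comm k 1)) (nₖ≡ (suc k))) n<nₖ)
    x≤ν : x ≤ ν k
    x≤ν = +-cancelˡ-≤ (σ k) x _ (subst₂ _≤_ n≡ (σ-suc k) n≤σ)
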